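{- Let $a>1$, $b>1$, $c>0$, $r>0$, $s>0$ be integers with $\gcd(a,b)>1$. Then the equation $(-1)^u r a^x + (-1)^v s b^y = c$ has at most three solutions $(x,y,u,v)$, except for sets of solutions which are members of families containing one of the basic forms $(2,2,4,1,3;0,0,1,1,3,2,4,2)$, $(2,2,3,1,1;0,1,0,2,1,0,2,0)$, $(6,2,8,1,7;0,0,1,1,2,2,3,5)$, or the associate of one of these. Moreover, there are infinitely many sets of solutions in basic form with $\gcd(a,b)>1$ consisting of three pairs (infinitely many cases of three solutions, even counting only basic forms).
   Context: A solution is a quadruple $(x,y,u,v)$ with $x,y$ nonnegative integers and $u,v\in\{0,1\}$ satisfying the equation; since $(x,y)$ determines $(u,v)$, a solution is referred to by the pair $(x,y)$. A set of solutions, written $(a,b,c,r,s;x_1,y_1,\dots,x_N,y_N)$, is the unordered set of $N>2$ distinct pairs $(x_i,y_i)$, each a solution for the given $a,b,c,r,s$. Two sets of solutions $(a,b,c,r,s;x_1,y_1,\dots,x_N,y_N)$ and $(A,B,C,R,S;X_1,Y_1,\dots,X_N,Y_N)$ are in the same family if $a$ and $A$ are both powers of one integer, $b$ and $B$ are both powers of one integer, and there is a positive rational $k$ with $kc=C$ such that for every $i$ there is $j$ with $kra^{x_i}=RA^{X_j}$ and $ksb^{y_i}=SB^{Y_j}$. A set of solutions is in basic form if $\gcd(r,sb)=\gcd(s,ra)=1$, $\min_i x_i=\min_i y_i=0$, and neither $a$ nor $b$ is a perfect power. The associate of $(a,b,c,r,s;x_1,y_1,\dots,x_N,y_N)$ is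 $(b,a,c,s,r;y_1,x_1,\dots,y_N,x_N)$. -}

module Defs where

open import Data.Nat using (ℕ; zero; suc; _+_; _*_; _^_; _≤_; _<_)
open import Data.Nat.GCD using (gcd)
open import Data.Integer as ℤ using (ℤ; +_; -_)
open import Data.Rational as ℚ using (ℚ; Positive)
open import Data.Bool using (Bool; true; false)
open import Data.Product using (_×_; _,_; proj₁; proj₂; ∃; ∃-syntax)
open import Data.List using (List; []; _∷_; length; map)
open import Data.Nat.ListAction using (sum)
open import Data.List.Relation.Unary.All using (All)
open import Data.List.Relation.Unary.Any using (Any)
open import Data.List.Relation.Unary.Unique.Propositional using (Unique)
open import Data.List.Membership.Propositional using (_∈_)
open import Relation.Binary.PropositionalEquality using (_≡_)
open import Relation.Nullary using (¬_)

-- (-1)^u as a sign applied to an integer; u ∈ {0,1} is encoded as Bool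
-- (false = 0, true = 1).
signed : Bool → ℤ → ℤ
signed false z = z
signed true  z = - z

IsSolution : (a b c r s : ℕ) → ℕ × ℕ → Set
IsSolution a b c r s (x , y) =
  ∃[ u ] ∃[ v ] (signed u (+ (r * a ^ x)) ℤ.+ signed v (+ (s * b ^ y)) ≡ + c)

-- A set of solutions (a,b,c,r,s; x_1,y_1,...,x_N,y_N): the data together with
-- the list of pairs (order irrelevant; distinctness and N > 2 are imposed by
-- the predicate IsSetOfSolutions below).
record SolSet : Set where
  constructor ⟨_,_,_,_,_⨾_⟩
  field
    a b c r s : ℕ
    pairs     : List (ℕ × ℕ)
open SolSet public

Standing : SolSet → Set
Standing S = (1 < a S) × (1 < b S) × (0 < c S) × (0 < r S) × (0 < s S)

IsSetOfSolutions : SolSet → Set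
IsSetOfSolutions S =
  Unique (pairs S) × (2 < length (pairs S)) ×
  All (IsSolution (a S) (b S) (c S) (r S) (s S)) (pairs S)

PowersOfOne : ℕ → ℕ → Set
PowersOfOne m n = ∃[ t ] ∃[ i ] ∃[ j ] (m ≡ t ^ i × n ≡ t ^ j)

ℕtoℚ : ℕ → ℚ
ℕtoℚ n = + n ℚ./ 1

SameFamily : SolSet → SolSet → Set
SameFamily S T =
  length (pairs S) ≡ length (pairs T) ×
  PowersOfOne (a S) (a T) × PowersOfOne (b S) (b T) ×
  ∃[ k ] (Positive k × k ℚ.* ℕtoℚ (c S) ≡ ℕtoℚ (c T) ×
    All (λ p → Any (λ q →
           (k ℚ.* ℕtoℚ (r S * a S ^ proj₁ p) ≡ ℕtoℚ (r T * a T ^ proj₁ q)) ×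
           (k ℚ.* ℕtoℚ (s S * b S ^ proj₂ p) ≡ ℕtoℚ (s T * b T ^ proj₂ q)))
         (pairs T))
        (pairs S))

PerfectPower : ℕ → Set
PerfectPower n = ∃[ t ] ∃[ k ] (2 ≤ k × n ≡ t ^ k)

-- basic form: gcd(r,sb) = gcd(s,ra) = 1, min x_i = min y_i = 0
-- (over ℕ: some x_i is 0 and some y_i is 0), a and b not perfect powers.
BasicForm : SolSet → Set
BasicForm S =
  gcd (r S) (s S * b S) ≡ 1 × gcd (s S) (r S * a S) ≡ 1 ×
  Any (λ p → proj₁ p ≡ 0) (pairs S) × Any (λ p → proj₂ p ≡ 0) (pairs S) ×
  ¬ PerfectPower (a S) × ¬ PerfectPower (b S)

swap : ℕ × ℕ → ℕ × ℕ
swap (x , y) = (y , x)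

associate : SolSet → SolSet
associate ⟨ a , b , c , r , s ⨾ ps ⟩ = ⟨ b , a , c , s , r ⨾ map swap ps ⟩

E₁ E₂ E₃ : SolSet
E₁ = ⟨ 2 , 2 , 4 , 1 , 3 ⨾ (0 , 0) ∷ (1 , 1) ∷ (3 , 2) ∷ (4 , 2) ∷ [] ⟩
E₂ = ⟨ 2 , 2 , 3 , 1 , 1 ⨾ (0 , 1) ∷ (0 , 2) ∷ (1 , 0) ∷ (2 , 0) ∷ [] ⟩
E₃ = ⟨ 6 , 2 , 8 , 1 , 7 ⨾ (0 , 0) ∷ (1 , 1) ∷ (2 , 2) ∷ (3 , 5) ∷ [] ⟩

Exceptional : List SolSet
Exceptional = E₁ ∷ E₂ ∷ E₃ ∷ associate E₁ ∷ associate E₂ ∷ associate E₃ ∷ []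

-- total size of all entries of a set of solutions (used to express
-- "infinitely many": unbounded size ⇔ infinitely many distinct such sets)
size : SolSet → ℕ
size S = a S + b S + c S + r S + s S + sum (map (λ p → proj₁ p + proj₂ p) (pairs S))

{-# OPTIONS --safe #-}

-- Fix a prime p dividing gcd(a,b). Among the p-adic valuations of r aˣ, s bʸ and c the least is attained twice, so a
-- solution has v(r aˣ) = v(c), or v(s bʸ) = v(c), or is "low": v(r aˣ) = v(s bʸ) < v(c). The first two conditions fix x,
-- respectively y, and each x (or y) belongs to at most two solutions; so without low solutions four solutions form a
-- cross through a point (x₀,y₀), and comparing sizes gives the family of E₂.
-- Otherwise the least low solution (x₀,y₀) lies strictly below all the others in both coordinates. With U = r aˣ⁰ and
-- W = s bʸ⁰ we have c ≤ U + W, so every other solution is a difference ±(U aⁱ − W bʲ) = c with i, j ≥ 1. Two of them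
-- sharing i or j, or ordered oppositely in i and j, leave finitely many (a, b, U : W : c). If three of them form a
-- chain, the lower two are low, hence proportional: A = aᵉ, B = bᶠ with v(A) = v(B), and they read ±(U Aᵗ − W Bᵗ) = c.
-- If A > B then A ≥ B + 3, while the two equations force (A/B)ᵗ to be almost constant; this leaves A = 6 and B = 2, 3.
-- The finitely many surviving equations are solved completely by a congruence and a search.
module Submission where

open import Defs
open import Data.Nat
open import Data.Nat.Properties
open import Data.Nat.Divisibility
open import Data.Nat.GCD using (gcd; mkGCD; module GCD; gcd-greatest; gcd[m,n]∣m; gcd[m,n]∣n; gcd[m,n]≡0⇒n≡0)
open import Data.Nat.Coprimality using (Coprime; coprime-divisor; coprime⇒gcd≡1)
open import Data.Nat.Induction using (<-rec)
open import Data.Nat.Primality using (Prime; prime[2]; euclidsLemma; prime⇒nonTrivial)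
open import Data.Nat.Primality.Factorisation using (factorise)
open import Data.Nat.Tactic.RingSolver using (solve; solve-∀)
open import Data.Product using (_×_; _,_; ∃-syntax; proj₁; proj₂)
open import Data.Sum using (_⊎_; inj₁; inj₂; [_,_]; [_,_]′)
open import Data.Empty using (⊥; ⊥-elim)
open import Data.List using (List; []; _∷_; length; map; lookup; filter; upTo; cartesianProduct)
open import Data.List.Properties using (length-map)
open import Data.List.Relation.Unary.Any as Any using (Any; here; there; any?)
open import Data.List.Relation.Unary.Any.Properties using (lookup-index)
open import Data.List.Relation.Unary.Unique.Propositional using (Unique)
open import Data.List.Membership.Propositional using (_∈_; lose)
open import Data.List.Membership.Propositional.Properties using (∈-filter⁺; ∈-upTo⁺; ∈-cartesianProduct⁺; ∈-map⁺; ∈-lookup)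
open import Relation.Binary.PropositionalEquality using (_≡_; _≢_; refl; sym; trans; cong; cong₂; subst; subst₂; ≢-sym; module ≡-Reasoning)
open import Relation.Binary.Definitions using (tri<; tri≈; tri>) renaming (Tri to Tri₃)
open import Relation.Nullary using (¬_; Dec; yes; no; ¬?)
open import Relation.Nullary.Decidable using (_×-dec_; _⊎-dec_; from-yes)

-- Three-term equations

-- Supplying the excess k turns the refutation of an inequality into a semiring identity.
beyond : ∀ {l r} → l ≤ r → ∀ k → l ≡ 1 + (r + k) → ⊥
beyond {l} {r} l≤r k eq =
  1+n≰n (≤-trans (≤-trans (s≤s (m≤m+n r k)) (≤-reflexive (sym eq))) l≤r)

-- *-monoʳ-≤ with the products written out, which the ring solver needs to see.
scale-≤ : ∀ k {m n} → m ≤ n → k * m ≤ k * n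
scale-≤ k = *-monoʳ-≤ k

cast-≤ : ∀ {l r l′ r′} → l ≤ r → l ≡ l′ → r ≡ r′ → l′ ≤ r′
cast-≤ le refl refl = le

cancel-≡ : ∀ {l r} → l ≡ r → ∀ e {l′ r′} → l ≡ e + l′ → r ≡ e + r′ → l′ ≡ r′
cancel-≡ eq e {l′} {r′} p q = +-cancelˡ-≡ e l′ r′ (trans (sym p) (trans eq q))

cancel-≤ : ∀ {l r} → l ≤ r → ∀ e {l′ r′} → l ≡ e + l′ → r ≡ e + r′ → l′ ≤ r′
cancel-≤ le e {l′} {r′} refl refl = +-cancelˡ-≤ e l′ r′ le

divide-≡ : ∀ {l r} → l ≡ r → ∀ e → 0 < e → ∀ {l′ r′} → l ≡ e * l′ → r ≡ e * r′ → l′ ≡ r′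
divide-≡ eq (suc e) _ {l′} {r′} p q = *-cancelˡ-≡ l′ r′ (suc e) (trans (sym p) (trans eq q))

divide-≤ : ∀ {l r} → l ≤ r → ∀ e → 0 < e → ∀ {l′ r′} → l ≡ e * l′ → r ≡ e * r′ → l′ ≤ r′
divide-≤ le (suc e) _ refl refl = *-cancelˡ-≤ (suc e) le

-- ± U ± W = c for c > 0, cleared of subtraction.
Tri : ℕ → ℕ → ℕ → Set
Tri U W c = (U + W ≡ c) ⊎ (U ≡ c + W) ⊎ (W ≡ c + U)

pattern sum-form e = inj₁ e
pattern left-form e = inj₂ (inj₁ e)
pattern right-form e = inj₂ (inj₂ e)

Tri-swap : ∀ {U W c} → Tri U W c → Tri W U c
Tri-swap {U} {W} (sum-form e) = sum-form (trans (+-comm W U) e)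
Tri-swap (left-form e) = right-form e
Tri-swap (right-form e) = left-form e

Tri⇒c≤ : ∀ {U W c} → Tri U W c → c ≤ U + W
Tri⇒c≤ (sum-form e) = ≤-reflexive (sym e)
Tri⇒c≤ {U} {W} {c} (left-form e) = ≤-trans (≤-trans (m≤m+n c W) (≤-reflexive (sym e))) (m≤m+n U W)
Tri⇒c≤ {U} {W} {c} (right-form e) = ≤-trans (≤-trans (m≤m+n c U) (≤-reflexive (sym e))) (m≤n+m W U)

Tri⇒U≤ : ∀ {U W c} → Tri U W c → U ≤ c + W
Tri⇒U≤ {U} {W} {c} (sum-form e) = ≤-trans (≤-trans (m≤m+n U W) (≤-reflexive e)) (m≤m+n c W)
Tri⇒U≤ (left-form e) = ≤-reflexive e
Tri⇒U≤ {U} {W} {c} (right-form e) = ≤-trans (≤-trans (m≤n+m U c) (≤-reflexive (sym e))) (m≤n+m W c)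

Tri⇒W≤ : ∀ {U W c} → Tri U W c → W ≤ c + U
Tri⇒W≤ t = Tri⇒U≤ (Tri-swap t)

Difference : ℕ → ℕ → ℕ → Set
Difference U W c = (U ≡ c + W) ⊎ (W ≡ c + U)

-- The sum form is too large: `U * X + W * Y` is at least twice the positive number `U + W`, which
-- already bounds c.
difference : ∀ {U W c X Y} → 0 < U → c ≤ U + W → 2 ≤ X → 2 ≤ Y →
             Tri (U * X) (W * Y) c → Difference (U * X) (W * Y) c
difference {suc u} {W} _ c≤ (s≤s (s≤s {n = x} _)) (s≤s (s≤s {n = y} _)) (sum-form e) =
  ⊥-elim (beyond (≤-trans (≤-reflexive e) c≤) (u + W + x + x * u + y * W)
    (solve (u ∷ W ∷ x ∷ y ∷ [])))
difference _ _ _ _ (inj₂ d) = d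

-- The proportion U : W : c = R : S : C, cross-multiplied to stay in ℕ. It fixes the equation up to
-- the rational factor that a family allows.
Scaled : (R S C U W c : ℕ) → Set
Scaled R S C U W c = (U * C ≡ R * c) × (W * C ≡ S * c)

-- X = aⁱ and F = bʲ′⁻ʲ for solutions (i , j), (i , j′) with the same i; then U : W : c = R : S : C.
data Tie : (X F R S C : ℕ) → Set where
  tie₁ : Tie 2 2 3 1 2
  tie₂ : Tie 2 4 5 1 6
  tie₃ : Tie 4 2 3 1 4
  tie₄ : Tie 6 2 1 1 2
  tie₅ : Tie 3 3 2 1 3

product-six : ∀ m n → m * n ≡ 6 →
  (m ≡ 1 × n ≡ 6) ⊎ (m ≡ 2 × n ≡ 3) ⊎ (m ≡ 3 × n ≡ 2) ⊎ (m ≡ 6 × n ≡ 1)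
product-six m n eq = split m n (∣⇒≤ (divides n (trans (sym eq) (*-comm m n)))) eq
  where
  split : ∀ m n → m ≤ 6 → m * n ≡ 6 →
    (m ≡ 1 × n ≡ 6) ⊎ (m ≡ 2 × n ≡ 3) ⊎ (m ≡ 3 × n ≡ 2) ⊎ (m ≡ 6 × n ≡ 1)
  split 1 n _ e = inj₁ (refl , trans (sym (+-identityʳ n)) e)
  split 2 n _ e = inj₂ (inj₁ (refl , *-cancelˡ-≡ n 3 2 e))
  split 3 n _ e = inj₂ (inj₂ (inj₁ (refl , *-cancelˡ-≡ n 2 3 e)))
  split 4 (suc (suc n)) _ e = ⊥-elim (beyond (≤-reflexive e) (1 + 4 * n) (solve (n ∷ [])))
  split 5 (suc (suc n)) _ e = ⊥-elim (beyond (≤-reflexive e) (3 + 5 * n) (solve (n ∷ [])))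
  split 6 n _ e = inj₂ (inj₂ (inj₂ (refl , *-cancelˡ-≡ n 1 6 e)))
  split (suc (suc (suc (suc (suc (suc (suc m))))))) n (s≤s (s≤s (s≤s (s≤s (s≤s (s≤s ())))))) e

TieResult : (X F U W c : ℕ) → Set
TieResult X F U W c = ∃[ R ] ∃[ S ] ∃[ C ] (Tie X F R S C × Scaled R S C U W c)

-- Eliminating U and W leaves a Diophantine equation in X = 2 + x, Y = 2 + y and F = 2 + e.
tie-sum : ∀ U W x y e → 0 < W → ¬ gcd (2 + y) (2 + e) ≡ 1 →
          U * (2 + x) ≡ U + W + W * (2 + y) →
          W * ((2 + y) * (2 + e)) ≡ U + W + U * (2 + x) →
          TieResult (2 + x) (2 + e) U W (U + W)
tie-sum U W x y e 0<W ncop h₁ h₂ = split x y e ncop k eliminated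
  where
  k : U * (1 + x) ≡ W * (3 + y)
  k = cancel-≡ h₁ U (solve (U ∷ x ∷ [])) (solve (U ∷ W ∷ y ∷ []))
  eliminated : (2 + y) * (2 + e) * (1 + x) ≡ (1 + x) + (3 + y) * (3 + x)
  eliminated = divide-≡ scaled W 0<W (solve (W ∷ x ∷ y ∷ e ∷ [])) (solve (W ∷ x ∷ y ∷ []))
    where
    open ≡-Reasoning
    scaled : W * ((2 + y) * (2 + e)) * (1 + x) ≡ W * (1 + x) + W * (3 + y) * (3 + x)
    scaled = begin
      W * ((2 + y) * (2 + e)) * (1 + x)           ≡⟨ cong (_* (1 + x)) h₂ ⟩
      (U + W + U * (2 + x)) * (1 + x)             ≡⟨ solve (U ∷ W ∷ x ∷ []) ⟩
      W * (1 + x) + U * (1 + x) * (3 + x)         ≡⟨ cong (λ z → W * (1 + x) + z * (3 + x)) k ⟩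
      W * (1 + x) + W * (3 + y) * (3 + x)         ∎
  split : ∀ x y e → ¬ gcd (2 + y) (2 + e) ≡ 1 → U * (1 + x) ≡ W * (3 + y) →
          (2 + y) * (2 + e) * (1 + x) ≡ (1 + x) + (3 + y) * (3 + x) →
          TieResult (2 + x) (2 + e) U W (U + W)
  split 0 y 0 _ k h = ⊥-elim (beyond (≤-reflexive (sym h)) (5 + y) (solve (y ∷ [])))
  split 0 y 1 _ k h = ⊥-elim (beyond (≤-reflexive (sym h)) 3 (solve (y ∷ [])))
  split 0 y 2 _ k h with refl ← cancel-≡ h (8 + 3 * y) {y} {2} (solve (y ∷ [])) (solve (y ∷ [])) =
    5 , 1 , 6 , tie₂ , scaled U W k
    where
    scaled : ∀ U W → U * 1 ≡ W * 5 → Scaled 5 1 6 U W (U + W)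
    scaled U W k with refl ← trans (sym (*-identityʳ U)) k = solve (W ∷ []) , solve (W ∷ [])
  -- (Y, F) = (2, 5) does satisfy the equation; it is excluded because Y and F will be positive
  -- powers of the same base.
  split 0 0 3 ncop k h = ⊥-elim (ncop refl)
  split 0 (suc y) 3 _ k h = ⊥-elim (beyond (≤-reflexive h) (1 + 2 * y) (solve (y ∷ [])))
  split 0 y (suc (suc (suc (suc e)))) _ k h =
    ⊥-elim (beyond (≤-reflexive h) (1 + 2 * e + 3 * y + e * y) (solve (y ∷ e ∷ [])))
  -- With F = 2 and X = 3 + x the equation becomes x * y = 6. The two factorisations with Y = 2 + y
  -- odd fall to `ncop`.
  split (suc x) y 0 ncop k h
    with product-six x y (cancel-≡ h (8 + 4 * x + 4 * y + x * y) {x * y} {6} (solve (x ∷ y ∷ [])) (solve (x ∷ y ∷ [])))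
  ... | inj₁ (refl , refl) = 3 , 1 , 4 , tie₃ , scaled U W k
    where
    scaled : ∀ U W → U * 3 ≡ W * 9 → Scaled 3 1 4 U W (U + W)
    scaled U W k with refl ← divide-≡ k 3 (s≤s z≤n) {U} {3 * W} (solve (U ∷ [])) (solve (W ∷ [])) =
      solve (W ∷ []) , solve (W ∷ [])
  ... | inj₂ (inj₁ (refl , refl)) = ⊥-elim (ncop refl)
  ... | inj₂ (inj₂ (inj₁ (refl , refl))) = 1 , 1 , 2 , tie₄ , scaled U W k
    where
    scaled : ∀ U W → U * 5 ≡ W * 5 → Scaled 1 1 2 U W (U + W)
    scaled U W k with refl ← *-cancelʳ-≡ U W 5 k = solve (W ∷ []) , solve (W ∷ [])
  ... | inj₂ (inj₂ (inj₂ (refl , refl))) = ⊥-elim (ncop refl)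
  split 1 1 1 _ k h = 2 , 1 , 3 , tie₅ , scaled U W k
    where
    scaled : ∀ U W → U * 2 ≡ W * 4 → Scaled 2 1 3 U W (U + W)
    scaled U W k with refl ← divide-≡ k 2 (s≤s z≤n) {U} {2 * W} (solve (U ∷ [])) (solve (W ∷ [])) =
      solve (W ∷ []) , solve (W ∷ [])
  split (suc x) 0 1 ncop k h = ⊥-elim (ncop refl)
  split (suc (suc x)) (suc y) 1 ncop k h = ⊥-elim (beyond (≤-reflexive h) (3 + 4 * x + 4 * y + 2 * x * y) (solve (x ∷ y ∷ [])))
  split 1 (suc (suc y)) 1 ncop k h = ⊥-elim (beyond (≤-reflexive h) (1 + 2 * y) (solve (y ∷ [])))
  split (suc x) y (suc (suc e)) _ k h =
    ⊥-elim (beyond (≤-reflexive h)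
      (1 + 4 * e + 4 * x + 4 * y + 2 * e * x + 2 * e * y + 3 * x * y + e * x * y)
      (solve (x ∷ y ∷ e ∷ [])))

-- The same elimination for a base solution U = c + W. The left side of `eliminated` is too large
-- unless X = F = 2, and then Y = 4.
tie-left : ∀ c W x y e → 0 < W →
           (c + W) * (2 + x) ≡ c + W * (2 + y) →
           W * ((2 + y) * (2 + e)) ≡ c + (c + W) * (2 + x) →
           TieResult (2 + x) (2 + e) (c + W) W c
tie-left c W x y e 0<W h₁ h₂ = split x y e k eliminated
  where
  k : c * (1 + x) + W * x ≡ W * y
  k = cancel-≡ h₁ (c + 2 * W) (solve (c ∷ W ∷ x ∷ [])) (solve (c ∷ W ∷ y ∷ []))
  eliminated : (2 + y) * (2 + e) * (1 + x) + x * (3 + x) ≡ y * (3 + x) + (2 + x) * (1 + x)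
  eliminated = divide-≡ scaled W 0<W (solve (W ∷ x ∷ y ∷ e ∷ [])) (solve (W ∷ x ∷ y ∷ []))
    where
    open ≡-Reasoning
    scaled : W * ((2 + y) * (2 + e)) * (1 + x) + W * x * (3 + x) ≡ W * y * (3 + x) + W * (2 + x) * (1 + x)
    scaled = begin
      W * ((2 + y) * (2 + e)) * (1 + x) + W * x * (3 + x)           ≡⟨ cong (λ z → z * (1 + x) + W * x * (3 + x)) h₂ ⟩
      (c + (c + W) * (2 + x)) * (1 + x) + W * x * (3 + x)           ≡⟨ solve (c ∷ W ∷ x ∷ []) ⟩
      (c * (1 + x) + W * x) * (3 + x) + W * (2 + x) * (1 + x)       ≡⟨ cong (λ z → z * (3 + x) + W * (2 + x) * (1 + x)) k ⟩
      W * y * (3 + x) + W * (2 + x) * (1 + x)                       ∎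
  split : ∀ x y e → c * (1 + x) + W * x ≡ W * y →
          (2 + y) * (2 + e) * (1 + x) + x * (3 + x) ≡ y * (3 + x) + (2 + x) * (1 + x) →
          TieResult (2 + x) (2 + e) (c + W) W c
  split 0 y 0 k h with refl ← cancel-≡ h (2 + 2 * y) {2} {y} (solve (y ∷ [])) (solve (y ∷ [])) =
    3 , 1 , 2 , tie₁ , scaled c W k
    where
    scaled : ∀ c W → c * 1 + W * 0 ≡ W * 2 → Scaled 3 1 2 (c + W) W c
    scaled c W k with refl ← trans {i = c} {j = c * 1 + W * 0} (solve (c ∷ W ∷ [])) k = solve (W ∷ []) , solve (W ∷ [])
  split (suc x) y 0 k h = ⊥-elim (beyond (≤-reflexive h) (5 + 4 * x + x * y) (solve (x ∷ y ∷ [])))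
  split x y (suc e) k h =
    ⊥-elim (beyond (≤-reflexive h) (3 + 2 * e + 6 * x + 2 * e * x + e * y + 2 * x * y + e * x * y)
      (solve (x ∷ y ∷ e ∷ [])))

shrink : ∀ {W} y e → 0 < W → W * ((2 + y) * (2 + e)) ≤ W * (2 + y) → ⊥
shrink {suc w} y e _ h =
  beyond h (1 + 2 * w + y + w * y + (1 + w) * (2 + y) * e) (solve (w ∷ y ∷ e ∷ []))

-- As Y * F > Y, the smaller exponent must give U X = c + W Y and the larger one W Y F = c + U X.
-- The base solution then leaves three cases. The case W = c + U fails, since the two equations add
-- up to W (Y F - Y) = 2 c < 2 W while Y F - Y ≥ 2.
tie : ∀ {U W c X Y F} → 0 < U → 0 < W → Tri U W c → 2 ≤ X → 2 ≤ Y → 2 ≤ F →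
      ¬ gcd Y F ≡ 1 →
      Tri (U * X) (W * Y) c → Tri (U * X) (W * (Y * F)) c → TieResult X F U W c
tie {U} {W} {c} 0<U 0<W t₀
    (s≤s (s≤s {n = x} _)) (s≤s (s≤s {n = y} _)) (s≤s (s≤s {n = e} _)) ncop t₁ t₂
  with difference 0<U (Tri⇒c≤ t₀) (s≤s (s≤s z≤n)) (s≤s (s≤s z≤n)) t₁
     | difference 0<U (Tri⇒c≤ t₀) (s≤s (s≤s z≤n)) (s≤s (s≤s z≤n)) t₂
... | inj₁ d₁ | inj₁ d₂ = ⊥-elim (shrink y e 0<W (≤-reflexive (+-cancelˡ-≡ c _ _ (trans (sym d₂) d₁))))
... | inj₂ d₁ | d =
    ⊥-elim (shrink y e 0<W (≤-trans (W≤ d) (≤-reflexive (sym d₁))))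
  where
  W≤ : Difference (U * (2 + x)) (W * ((2 + y) * (2 + e))) c → W * ((2 + y) * (2 + e)) ≤ c + U * (2 + x)
  W≤ d = Tri⇒W≤ (inj₂ d)
... | inj₁ d₁ | inj₂ d₂ with t₀
...   | sum-form refl = tie-sum U W x y e 0<W ncop d₁ d₂
...   | left-form refl = tie-left c W x y e 0<W d₁ d₂
...   | right-form refl = ⊥-elim (tie-right U 0<U (trans d₂ (cong (c +_) d₁)))
  where
  tie-right : ∀ U → 0 < U → (c + U) * ((2 + y) * (2 + e)) ≡ c + (c + (c + U) * (2 + y)) → ⊥
  tie-right (suc u) _ h = beyond (≤-reflexive h) (1 + 2 * u + (c + 1 + u) * (y + (2 + y) * e))
    (solve (c ∷ u ∷ y ∷ e ∷ []))

-- Oppositely ordered pairs, crosses and proportional pairs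

inversion-bound : ∀ {U W c X₁ X₂ Y₁ Y₂} → 2 * X₁ ≤ X₂ → 2 * Y₂ ≤ Y₁ →
  Tri (U * X₁) (W * Y₁) c → Tri (U * X₂) (W * Y₂) c → U * X₁ + W * Y₂ ≤ c + c
inversion-bound {U} {W} {c} {X₁} {X₂} {Y₁} {Y₂} X₁≪X₂ Y₂≪Y₁ t₁ t₂ =
  cancel-≤ (≤-trans (+-mono-≤ (scale-≤ U X₁≪X₂) (scale-≤ W Y₂≪Y₁)) (+-mono-≤ (Tri⇒U≤ t₂) (Tri⇒W≤ t₁)))
    (U * X₁ + W * Y₂) (solve (U ∷ W ∷ X₁ ∷ Y₂ ∷ [])) (solve (U ∷ W ∷ X₁ ∷ Y₂ ∷ c ∷ []))

-- `inversion-bound` gives U X₁ + W Y₂ ≤ 2 c ≤ 2 (U + W), while X₁, Y₂ ≥ 2 gives the reverse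
-- inequality. Equality throughout forces X₁ = Y₂ = 2 and c = U + W.
inversion : ∀ {U W c X₁ X₂ Y₁ Y₂} → 0 < U → 0 < W → c ≤ U + W →
  2 ≤ X₁ → 2 ≤ Y₂ → 2 * X₁ ≤ X₂ → 2 * Y₂ ≤ Y₁ →
  Tri (U * X₁) (W * Y₁) c → Tri (U * X₂) (W * Y₂) c →
  X₁ ≡ 2 × Y₂ ≡ 2 × Scaled 1 1 2 U W c
inversion {U} {W} {c} {X₁} {X₂} {Y₁} {Y₂} 0<U 0<W c≤ 2≤X₁ 2≤Y₂ X₁≪X₂ Y₂≪Y₁ t₁ t₂
  with inversion-bound {U} {W} X₁≪X₂ Y₂≪Y₁ t₁ t₂
... | bound with X₁≡2 U W 0<U X₁ Y₂ 2≤X₁ 2≤Y₂ (≤-trans bound (+-mono-≤ c≤ c≤))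
               | X₁≡2 W U 0<W Y₂ X₁ 2≤Y₂ 2≤X₁ (cast-≤ (≤-trans bound (+-mono-≤ c≤ c≤))
                   (+-comm (U * X₁) (W * Y₂)) (cong₂ _+_ (+-comm U W) (+-comm U W)))
  where
  X₁≡2 : ∀ U W → 0 < U → ∀ X Y → 2 ≤ X → 2 ≤ Y → U * X + W * Y ≤ U + W + (U + W) → X ≡ 2
  X₁≡2 U W _ 2 Y _ _ _ = refl
  X₁≡2 (suc u) W _ (suc (suc (suc x))) (suc (suc y)) (s≤s (s≤s _)) (s≤s (s≤s _)) h =
    ⊥-elim (beyond h (u + x + u * x + W * y) (solve (u ∷ W ∷ x ∷ y ∷ [])))
  X₁≡2 U W _ 1 Y (s≤s ()) _ _
  X₁≡2 U W _ _ 1 _ (s≤s ()) _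
... | refl | refl = refl , refl , scaled U W c c≡ U≡W
  where
  c≡ : c ≡ U + W
  c≡ = ≤-antisym c≤ (divide-≤ bound 2 (s≤s z≤n) {U + W} {c} (solve (U ∷ W ∷ [])) (solve (c ∷ [])))
  -- Applied with X = X₂ ≥ 2 X₁ = 4: then 4 U ≤ U X₂ ≤ c + 2 W = U + 3 W. The symmetric use with Y₁
  -- gives W ≤ U.
  half : ∀ U W X → 4 ≤ X → U * X ≤ c + W * 2 → c ≡ U + W → U ≤ W
  half U W X 4≤X h refl = *-cancelˡ-≤ 3 (cancel-≤ (≤-trans (scale-≤ U 4≤X) h) U {3 * U} {3 * W}
    (solve (U ∷ [])) (solve (U ∷ W ∷ [])))
  U≡W : U ≡ W
  U≡W = ≤-antisym (half U W X₂ X₁≪X₂ (Tri⇒U≤ t₂) c≡)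
                  (half W U Y₁ Y₂≪Y₁ (Tri⇒W≤ t₁) (trans c≡ (+-comm U W)))
  scaled : ∀ U W c → c ≡ U + W → U ≡ W → Scaled 1 1 2 U W c
  scaled U W c refl refl = solve (U ∷ []) , solve (U ∷ [])

-- Since U ≤ W, neither of the first two solutions can be U = c + W Y, and as Y₁ < Y₂ they are U + W
-- Y₁ = c and W Y₂ = c + U. Hence W Y₁ ≤ W Y₂ - W Y₁ = 2 U ≤ 2 W, so Y₁ = 2, U = W and c = 3 W. The
-- other two solutions then have X = 2 or X = 4, and being distinct one of them has X = 2.
cross : ∀ {U W c X₁ X₂ Y₁ Y₂} → 0 < U → 0 < W → U ≤ W →
  2 ≤ Y₁ → 2 * Y₁ ≤ Y₂ → ¬ X₁ ≡ X₂ →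
  Tri U (W * Y₁) c → Tri U (W * Y₂) c → Tri (U * X₁) W c → Tri (U * X₂) W c →
  Y₁ ≡ 2 × (X₁ ≡ 2 ⊎ X₂ ≡ 2) × Scaled 1 1 3 U W c
cross {U} {W} {c} {X₁} {X₂} {Y₁} {Y₂} 0<U 0<W U≤W 2≤Y₁ Y₁≪Y₂ X₁≢X₂ t₁ t₂ s₁ s₂ =
  body (sums W (W * Y₁) 0<W U≤W (2W≤ Y₁ 2≤Y₁) t₁)
       (sums W (W * Y₂) 0<W U≤W (2W≤ Y₂ (≤-trans 2≤Y₁ (≤-trans (m≤m+n Y₁ _) Y₁≪Y₂))) t₂)
  where
  2W≤ : ∀ Y → 2 ≤ Y → W * 2 ≤ W * Y
  2W≤ Y 2≤Y = scale-≤ W 2≤Y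
  sums : ∀ {U c} W V → 0 < W → U ≤ W → W * 2 ≤ V → Tri U V c → (U + V ≡ c) ⊎ (V ≡ c + U)
  sums W V 0<W U≤W 2W≤V (sum-form e) = inj₁ e
  sums W V 0<W U≤W 2W≤V (right-form e) = inj₂ e
  sums {U} {c} (suc w) V _ U≤W 2W≤V (left-form refl) =
    ⊥-elim (beyond (≤-trans (+-mono-≤ (≤-refl {c}) 2W≤V) U≤W) (c + w) (solve (c ∷ w ∷ [])))
  finish : ∀ U W c Y₁ Y₂ → 0 < W → 2 ≤ Y₁ → 2 * Y₁ ≤ Y₂ → U ≤ W → U + W * Y₁ ≡ c → W * Y₂ ≡ c + U →
           Y₁ ≡ 2 × U ≡ W × c ≡ 3 * W
  finish U W c 1 Y₂ _ (s≤s ()) _ _ _ _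
  finish U (suc w) c (suc (suc (suc y))) Y₂ _ _ le U≤W refl e₂ =
    ⊥-elim (beyond (≤-trans (scale-≤ (1 + w) le) (≤-trans (≤-reflexive e₂)
       (+-mono-≤ (+-mono-≤ U≤W (≤-refl {(1 + w) * (3 + y)})) U≤W))) (w + y + w * y) (solve (w ∷ y ∷ [])))
  finish U W c 2 Y₂ 0<W _ le U≤W refl e₂ = refl , U≡W , c≡ U W U≡W
    where
    c≡ : ∀ U W → U ≡ W → U + W * 2 ≡ 3 * W
    c≡ U W refl = solve (U ∷ [])
    W≤U : W ≤ U
    W≤U = *-cancelˡ-≤ 2 (cancel-≤ (≤-trans (scale-≤ W le) (≤-reflexive e₂)) (W * 2) {2 * W} {2 * U}
             (solve (W ∷ [])) (solve (U ∷ W ∷ [])))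
    U≡W : U ≡ W
    U≡W = ≤-antisym U≤W W≤U
  decide : ∀ W X → 0 < W → Tri (W * X) W (3 * W) → X ≡ 2 ⊎ X ≡ 4
  decide W X 0<W (sum-form e) = inj₁ (+-cancelʳ-≡ 1 X 2 (divide-≡ e W 0<W (solve (W ∷ X ∷ [])) (*-comm 3 W)))
  decide W X 0<W (left-form e) = inj₂ (divide-≡ e W 0<W refl (solve (W ∷ [])))
  decide (suc w) X _ (right-form e) = ⊥-elim (beyond (≤-reflexive (sym e)) (1 + 2 * w + (1 + w) * X) (solve (w ∷ X ∷ [])))
  pick : X₁ ≡ 2 ⊎ X₁ ≡ 4 → X₂ ≡ 2 ⊎ X₂ ≡ 4 → X₁ ≡ 2 ⊎ X₂ ≡ 2
  pick (inj₁ e) _ = inj₁ e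
  pick (inj₂ _) (inj₁ e) = inj₂ e
  pick (inj₂ e) (inj₂ f) = ⊥-elim (X₁≢X₂ (trans e (sym f)))
  conclude : Y₁ ≡ 2 × U ≡ W × c ≡ 3 * W → Y₁ ≡ 2 × (X₁ ≡ 2 ⊎ X₂ ≡ 2) × Scaled 1 1 3 U W c
  conclude (p , refl , refl) = p , pick (decide U X₁ 0<U s₁) (decide U X₂ 0<U s₂) , (solve (U ∷ []) , solve (U ∷ []))
  big : W * Y₂ ≤ W * Y₁ → ⊥
  big h = grow W Y₁ 0<W 2≤Y₁ (≤-trans (scale-≤ W Y₁≪Y₂) h)
    where
    grow : ∀ W Y → 0 < W → 2 ≤ Y → W * (2 * Y) ≤ W * Y → ⊥
    grow (suc w) (suc y) _ _ h = beyond h (w + y + w * y) (solve (w ∷ y ∷ []))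
  body : (U + W * Y₁ ≡ c) ⊎ (W * Y₁ ≡ c + U) → (U + W * Y₂ ≡ c) ⊎ (W * Y₂ ≡ c + U) →
         Y₁ ≡ 2 × (X₁ ≡ 2 ⊎ X₂ ≡ 2) × Scaled 1 1 3 U W c
  body (inj₁ e) (inj₂ f) = conclude (finish U W c Y₁ Y₂ 0<W 2≤Y₁ Y₁≪Y₂ U≤W e f)
  body (inj₁ e) (inj₁ f) = ⊥-elim (big (≤-reflexive (+-cancelˡ-≡ U _ _ (trans f (sym e)))))
  body (inj₂ e) f = ⊥-elim (big (≤-trans (W≤ f) (≤-reflexive (sym e))))
    where
    W≤ : (U + W * Y₂ ≡ c) ⊎ (W * Y₂ ≡ c + U) → W * Y₂ ≤ c + U
    W≤ (inj₁ g) = Tri⇒W≤ (sum-form g)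
    W≤ (inj₂ g) = ≤-reflexive g

-- By c ≤ U + W each solution bounds U / W from one side; multiplying the two bounds eliminates U and W.
ratio-bound : ∀ {U W c X₁ Y₁ X₂ Y₂} → 0 < U → 0 < W → c ≤ U + W → 0 < Y₁ → 0 < X₂ →
  Tri (U * X₁) (W * Y₁) c → Tri (U * X₂) (W * Y₂) c →
  X₂ * Y₁ ≤ X₂ + X₁ * Y₂ + Y₂ + X₁ + Y₁
ratio-bound {U} {W} {c} {X₁} {suc y₁} {suc x₂} {Y₂} 0<U 0<W c≤ _ _ t₁ t₂ =
  cast-≤ (+-mono-≤ (≤-refl {1 + x₂ + y₁}) reduced) (solve (x₂ ∷ y₁ ∷ [])) (solve (x₂ ∷ y₁ ∷ X₁ ∷ Y₂ ∷ []))
  where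
  up : U * x₂ ≤ W * (1 + Y₂)
  up = cancel-≤ (≤-trans (Tri⇒U≤ t₂) (+-mono-≤ c≤ (≤-refl {W * Y₂}))) U
         (solve (U ∷ x₂ ∷ [])) (solve (U ∷ W ∷ Y₂ ∷ []))
  down : W * y₁ ≤ U * (1 + X₁)
  down = cancel-≤ (≤-trans (Tri⇒W≤ t₁) (+-mono-≤ c≤ (≤-refl {U * X₁}))) W
         (solve (W ∷ y₁ ∷ [])) (solve (U ∷ W ∷ X₁ ∷ []))
  reduced : x₂ * y₁ ≤ (1 + Y₂) * (1 + X₁)
  reduced = divide-≤ (*-mono-≤ up down) (U * W) (*-mono-< {0} {U} {0} {W} 0<U 0<W)
         (solve (U ∷ W ∷ x₂ ∷ y₁ ∷ [])) (solve (U ∷ W ∷ X₁ ∷ Y₂ ∷ []))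

-- Used with X₁ = Aᵗ, Y₁ = Bᵗ, X = Aᵈ, Y = Bᵈ, where t and t + d are the exponents of the two
-- solutions; `bound` is `ratio-bound`. Multiplying by A² lets Y / X ≤ B / A and Y₁ / X₁ ≤ B / A
-- remove Y and X₁; then A ≤ X removes X.
module Growth {A B X₁ Y₁ X Y : ℕ} (0<X₁ : 0 < X₁) (0<X : 0 < X)
  (YA≤XB : Y * A ≤ X * B) (Y₁A≤X₁B : Y₁ * A ≤ X₁ * B) (A≤X : A ≤ X)
  (bound : X₁ * X * Y₁ ≤ X₁ * X + X₁ * (Y₁ * Y) + Y₁ * Y + X₁ + Y₁) where

  bound-XY₁ : A * A * X * Y₁ ≤ A * A * X + A * B * X * Y₁ + B * B * X + A * A + A * B
  bound-XY₁ = divide-≤ (≤-trans (cast-≤ (scale-≤ (A * A) bound) refl expand) replace) X₁ 0<X₁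
      (solve (A ∷ X₁ ∷ X ∷ Y₁ ∷ [])) (solve (A ∷ B ∷ X₁ ∷ X ∷ Y₁ ∷ []))
    where
    expand : A * A * (X₁ * X + X₁ * (Y₁ * Y) + Y₁ * Y + X₁ + Y₁) ≡
             A * A * (X₁ * X) + A * X₁ * Y₁ * (Y * A) + (Y₁ * A) * (Y * A) + A * A * X₁ + A * (Y₁ * A)
    expand = solve (A ∷ X₁ ∷ X ∷ Y₁ ∷ Y ∷ [])
    replace : A * A * (X₁ * X) + A * X₁ * Y₁ * (Y * A) + (Y₁ * A) * (Y * A) + A * A * X₁ + A * (Y₁ * A) ≤
              A * A * (X₁ * X) + A * X₁ * Y₁ * (X * B) + (X₁ * B) * (X * B) + A * A * X₁ + A * (X₁ * B)
    replace = +-mono-≤ (+-mono-≤ (+-mono-≤ (+-mono-≤ (≤-refl {A * A * (X₁ * X)}) (scale-≤ (A * X₁ * Y₁) YA≤XB))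
                (*-mono-≤ Y₁A≤X₁B YA≤XB)) (≤-refl {A * A * X₁})) (scale-≤ A Y₁A≤X₁B)

  bound-Y₁ : A * A * Y₁ ≤ A * A + A * B * Y₁ + B * B + A + B
  bound-Y₁ = divide-≤ (≤-trans bound-XY₁ (+-mono-≤ (+-mono-≤ (≤-refl {A * A * X + A * B * X * Y₁ + B * B * X}) (scale-≤ A A≤X)) (*-mono-≤ A≤X (≤-refl {B})))) X 0<X
      (solve (A ∷ X ∷ Y₁ ∷ [])) (solve (A ∷ B ∷ X ∷ Y₁ ∷ []))

-- The inequality reads A (A - B) Y₁ ≤ A² + B² + A + B. With A - B ≥ 3 and Y₁ ≥ B its left side
-- outgrows the right; A = 6 with Y₁ = B = 2 or 3 gives equality, and every other case misses by a
-- polynomial with nonnegative coefficients.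
small-bases : ∀ {A B Y₁} → 2 ≤ B → 3 + B ≤ A → 6 ≤ A → B ≤ Y₁ →
  A * A * Y₁ ≤ A * A + A * B * Y₁ + B * B + A + B →
  A ≡ 6 × Y₁ ≡ B × (B ≡ 2 ⊎ B ≡ 3)
small-bases {A} {B} {Y₁} 2≤B B≪A 6≤A B≤Y₁ h =
  split A B (Y₁ ∸ B) 2≤B B≪A 6≤A Y₁ (sym (m+[n∸m]≡n B≤Y₁)) h
  where
  split : ∀ A B y → 2 ≤ B → 3 + B ≤ A → 6 ≤ A → ∀ Y₁ → Y₁ ≡ B + y →
    A * A * Y₁ ≤ A * A + A * B * Y₁ + B * B + A + B → A ≡ 6 × Y₁ ≡ B × (B ≡ 2 ⊎ B ≡ 3)
  split 6 2 0 _ _ _ _ refl _ = refl , refl , inj₁ refl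
  split 6 3 0 _ _ _ _ refl _ = refl , refl , inj₂ refl
  split 6 2 (suc y) _ _ _ _ refl h = ⊥-elim (beyond h (23 + 24 * y) (solve (y ∷ [])))
  split 6 3 (suc y) _ _ _ _ refl h = ⊥-elim (beyond h (17 + 18 * y) (solve (y ∷ [])))
  split (suc (suc (suc (suc (suc (suc (suc e))))))) 2 y _ _ _ _ refl h =
    ⊥-elim (beyond h (7 + 9 * e + 35 * y + e * e + 12 * e * y + e * e * y) (solve (e ∷ y ∷ [])))
  split (suc (suc (suc (suc (suc (suc (suc e))))))) 3 y _ _ _ _ refl h =
    ⊥-elim (beyond h (15 + 18 * e + 28 * y + 2 * e * e + 11 * e * y + e * e * y) (solve (e ∷ y ∷ [])))
  split A (suc (suc (suc (suc f)))) y _ le _ _ refl h =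
    large (A ∸ (7 + f)) (sym (m+[n∸m]≡n le)) h
    where
    large : ∀ {A} e → A ≡ 7 + f + e →
      A * A * (4 + f + y) ≤ A * A + A * (4 + f) * (4 + f + y) + (4 + f) * (4 + f) + A + (4 + f) →
      A ≡ 6 × 4 + f + y ≡ 4 + f × (4 + f ≡ 2 ⊎ 4 + f ≡ 3)
    large e refl h = ⊥-elim (beyond h (7 + 25 * e + 9 * f + 21 * y + 3 * e * e + 12 * e * f + 10 * e * y
      + f * f + 3 * f * y + e * e * f + e * e * y + e * f * f + e * f * y) (solve (e ∷ f ∷ y ∷ [])))
  split _ 1 _ (s≤s ()) _ _ _ _ _
  split 1 _ _ _ _ (s≤s ()) _ _ _
  split 2 _ _ _ _ (s≤s (s≤s ())) _ _ _
  split 3 _ _ _ _ (s≤s (s≤s (s≤s ()))) _ _ _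
  split 4 _ _ _ _ (s≤s (s≤s (s≤s (s≤s ())))) _ _ _
  split 5 _ _ _ _ (s≤s (s≤s (s≤s (s≤s (s≤s ()))))) _ _ _

-- Once `small-bases` has fixed A, B and Y₁, the finer inequality `bound-XY₁`, which still contains
-- X, becomes 8 X ≤ 48 or 9 X ≤ 54 and so bounds X by 6.
growth : ∀ {A B X₁ Y₁ X Y} → 0 < X₁ → 2 ≤ B → 3 + B ≤ A → 6 ≤ A → B ≤ Y₁ → A ≤ X →
  Y * A ≤ X * B → Y₁ * A ≤ X₁ * B →
  X₁ * X * Y₁ ≤ X₁ * X + X₁ * (Y₁ * Y) + Y₁ * Y + X₁ + Y₁ →
  A ≡ 6 × X ≡ 6 × Y₁ ≡ B × (B ≡ 2 ⊎ B ≡ 3)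
growth {A} {B} {X₁} {Y₁} {X} {Y} 0<X₁ 2≤B B≪A 6≤A B≤Y₁ A≤X p q bound =
  go (small-bases 2≤B B≪A 6≤A B≤Y₁ bound-Y₁) bound-XY₁
  where
  open Growth {A} {B} {X₁} {Y₁} {X} {Y} 0<X₁ (≤-trans (≤-trans (s≤s z≤n) 6≤A) A≤X) p q A≤X bound
  go : A ≡ 6 × Y₁ ≡ B × (B ≡ 2 ⊎ B ≡ 3) →
       A * A * X * Y₁ ≤ A * A * X + A * B * X * Y₁ + B * B * X + A * A + A * B →
       A ≡ 6 × X ≡ 6 × Y₁ ≡ B × (B ≡ 2 ⊎ B ≡ 3)
  go (refl , refl , inj₁ refl) h = refl ,
    ≤-antisym (*-cancelˡ-≤ 8 (cancel-≤ h (64 * X) {8 * X} {8 * 6} (solve (X ∷ [])) (solve (X ∷ [])))) A≤X ,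
    refl , inj₁ refl
  go (refl , refl , inj₂ refl) h = refl ,
    ≤-antisym (*-cancelˡ-≤ 9 (cancel-≤ h (99 * X) {9 * X} {9 * 6} (solve (X ∷ [])) (solve (X ∷ [])))) A≤X ,
    refl , inj₂ refl

-- With c ≤ U + W the first solution gives W ≤ 7 U and the second 35 U ≤ 5 W, so W = 7 U. The first
-- equation then yields c = 8 U.
scaled-6-2 : ∀ {U W c} → 0 < U → c ≤ U + W → Tri (U * 6) (W * 2) c → Tri (U * 36) (W * 4) c →
             Scaled 1 7 8 U W c
scaled-6-2 {U} {W} {c} 0<U c≤ t₁ t₂ =
  go 0<U (≤-antisym W≤ W≥) (difference {U} {W} 0<U c≤ (s≤s (s≤s z≤n)) (s≤s (s≤s z≤n)) t₁)
  where
  W≤ : W ≤ 7 * U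
  W≤ = cancel-≤ (≤-trans (Tri⇒W≤ t₁) (+-mono-≤ c≤ (≤-refl {U * 6}))) W (solve (W ∷ [])) (solve (U ∷ W ∷ []))
  W≥ : 7 * U ≤ W
  W≥ = *-cancelˡ-≤ 5 (cancel-≤ (≤-trans (Tri⇒U≤ t₂) (+-mono-≤ c≤ (≤-refl {W * 4}))) U {5 * (7 * U)} {5 * W}
        (solve (U ∷ [])) (solve (U ∷ W ∷ [])))
  go : ∀ {U W} → 0 < U → W ≡ 7 * U → Difference (U * 6) (W * 2) c → Scaled 1 7 8 U W c
  go {suc u} _ refl (inj₁ e) = ⊥-elim (beyond (≤-reflexive (sym e)) (7 + 8 * u + c) (solve (u ∷ c ∷ [])))
  go {U} _ refl (inj₂ e)
    with refl ← cancel-≡ e (U * 6) {8 * U} {c} (solve (U ∷ [])) (solve (U ∷ c ∷ [])) =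
    solve (U ∷ []) , solve (U ∷ [])

scaled-6-3 : ∀ {U W c} → 0 < U → c ≤ U + W → Tri (U * 6) (W * 3) c → Tri (U * 36) (W * 9) c →
             Scaled 2 7 9 U W c
scaled-6-3 {U} {W} {c} 0<U c≤ t₁ t₂ =
  go 0<U (≤-antisym W≤ W≥) (difference {U} {W} 0<U c≤ (s≤s (s≤s z≤n)) (s≤s (s≤s z≤n)) t₁)
  where
  W≤ : 2 * W ≤ 7 * U
  W≤ = cancel-≤ (≤-trans (Tri⇒W≤ t₁) (+-mono-≤ c≤ (≤-refl {U * 6}))) W (solve (W ∷ [])) (solve (U ∷ W ∷ []))
  W≥ : 7 * U ≤ 2 * W
  W≥ = *-cancelˡ-≤ 5 (cancel-≤ (≤-trans (Tri⇒U≤ t₂) (+-mono-≤ c≤ (≤-refl {W * 9}))) U {5 * (7 * U)} {5 * (2 * W)}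
        (solve (U ∷ [])) (solve (U ∷ W ∷ [])))
  go : 0 < U → 2 * W ≡ 7 * U → Difference (U * 6) (W * 3) c → Scaled 2 7 9 U W c
  go 0<U 2W≡7U (inj₁ e) = ⊥-elim (tooSmall U 0<U (begin
    2 * c + 21 * U        ≡⟨ solve (c ∷ U ∷ []) ⟩
    2 * c + 3 * (7 * U)   ≡⟨ cong (λ z → 2 * c + 3 * z) 2W≡7U ⟨
    2 * c + 3 * (2 * W)   ≡⟨ solve (c ∷ W ∷ []) ⟩
    2 * (c + W * 3)       ≡⟨ cong (2 *_) e ⟨
    2 * (U * 6)           ∎))
    where
    open ≡-Reasoning
    tooSmall : ∀ U → 0 < U → 2 * c + 21 * U ≡ 2 * (U * 6) → ⊥
    tooSmall (suc u) _ h = beyond (≤-reflexive h) (8 + 9 * u + 2 * c) (solve (u ∷ c ∷ []))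
  go _ 2W≡7U (inj₂ e) = 9U≡2c , *-cancelˡ-≡ (W * 9) (7 * c) 2 (begin
    2 * (W * 9)     ≡⟨ solve (W ∷ []) ⟩
    (2 * W) * 9     ≡⟨ cong (_* 9) 2W≡7U ⟩
    7 * U * 9       ≡⟨ solve (U ∷ []) ⟩
    7 * (U * 9)     ≡⟨ cong (7 *_) 9U≡2c ⟩
    7 * (2 * c)     ≡⟨ solve (c ∷ []) ⟩
    2 * (7 * c)     ∎)
    where
    open ≡-Reasoning
    21U≡ : 21 * U ≡ 2 * c + 12 * U
    21U≡ = begin
      21 * U            ≡⟨ solve (U ∷ []) ⟩
      3 * (7 * U)       ≡⟨ cong (3 *_) 2W≡7U ⟨
      3 * (2 * W)       ≡⟨ solve (W ∷ []) ⟩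
      2 * (W * 3)       ≡⟨ cong (2 *_) e ⟩
      2 * (c + U * 6)   ≡⟨ solve (c ∷ U ∷ []) ⟩
      2 * c + 12 * U    ∎
    9U≡2c : U * 9 ≡ 2 * c
    9U≡2c = cancel-≡ 21U≡ (12 * U) (solve (U ∷ [])) (solve (c ∷ U ∷ []))

-- Valuations

record Val (p n v : ℕ) : Set where
  constructor val
  field
    cofactor : ℕ
    factored : n ≡ p ^ v * cofactor
    p∤cofactor : ¬ p ∣ cofactor

2≤prime : ∀ {p} → Prime p → 2 ≤ p
2≤prime pp = nonTrivial⇒n>1 _ {{prime⇒nonTrivial pp}}

val-exists : ∀ {p} → Prime p → ∀ n → 0 < n → ∃[ v ] Val p n v
val-exists {p} pp = <-rec (λ n → 0 < n → ∃[ v ] Val p n v) step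
  where
  step : ∀ n → (∀ {m} → m < n → 0 < m → ∃[ v ] Val p m v) → 0 < n → ∃[ v ] Val p n v
  step n rec 0<n with p ∣? n
  ... | no p∤n = 0 , val n (sym (+-identityʳ n)) p∤n
  ... | yes (divides zero refl) = ⊥-elim (1+n≰n 0<n)
  ... | yes (divides (suc q) refl)
      with v , val m eq p∤m ← rec (m<m*n (suc q) p (2≤prime pp)) (s≤s z≤n) =
      suc v , val m (trans (cong (_* p) eq) (rearrange (p ^ v))) p∤m
    where
    rearrange : ∀ P → P * m * p ≡ p * P * m
    rearrange P = solve (P ∷ m ∷ p ∷ [])

val-* : ∀ {p m n v w} → Prime p → Val p m v → Val p n w → Val p (m * n) (v + w)
val-* {p} {m} {n} {v} {w} pp (val m′ refl p∤m′) (val n′ refl p∤n′) =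
  val (m′ * n′) eq (λ d → [ p∤m′ , p∤n′ ] (euclidsLemma m′ n′ pp d))
  where
  rearrange : ∀ P Q → P * m′ * (Q * n′) ≡ P * Q * (m′ * n′)
  rearrange P Q = solve (P ∷ Q ∷ m′ ∷ n′ ∷ [])
  eq : p ^ v * m′ * (p ^ w * n′) ≡ p ^ (v + w) * (m′ * n′)
  eq = trans (rearrange (p ^ v) (p ^ w)) (cong (_* (m′ * n′)) (sym (^-distribˡ-+-* p v w)))

val-^ : ∀ {p n v} → Prime p → Val p n v → ∀ x → Val p (n ^ x) (x * v)
val-^ pp vn zero = val 1 refl (λ p∣1 → 1+n≰n (≤-trans (2≤prime pp) (∣⇒≤ p∣1)))
val-^ pp vn (suc x) = val-* pp vn (val-^ pp vn x)

val-max : ∀ {p n v} → Prime p → Val p n v → ∀ w → p ^ w ∣ n → w ≤ v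
val-max {p} {n} {v} pp (val m refl p∤m) w d with w ≤? v
... | yes w≤v = w≤v
... | no w≰v = ⊥-elim (p∤m (*-cancelˡ-∣ (p ^ v) {{m^n≢0 p v {{>-nonZero (<-trans (s≤s z≤n) (2≤prime pp))}}}}
      (∣-trans (divides (p ^ (w ∸ suc v)) (trans (cong (p ^_) (sym (m∸n+n≡m (≰⇒> w≰v))))
         (trans (^-distribˡ-+-* p (w ∸ suc v) (suc v)) (cong (p ^ (w ∸ suc v) *_) (*-comm p (p ^ v)))))) d)))

val-∣ : ∀ {p n v} → Val p n v → ∀ w → w ≤ v → p ^ w ∣ n
val-∣ {p} {n} {v} (val m refl _) w w≤v = ∣-trans (divides (p ^ (v ∸ w))
  (trans (cong (p ^_) (sym (m∸n+n≡m w≤v))) (^-distribˡ-+-* p (v ∸ w) w))) (m∣m*n m)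

Tri-∣c : ∀ {d U W c} → Tri U W c → d ∣ U → d ∣ W → d ∣ c
Tri-∣c (sum-form refl) p q = ∣m∣n⇒∣m+n p q
Tri-∣c {d} {U} {W} {c} (left-form refl) p q = ∣m+n∣m⇒∣n (subst (d ∣_) (+-comm c W) p) q
Tri-∣c {d} {U} {W} {c} (right-form refl) p q = ∣m+n∣m⇒∣n (subst (d ∣_) (+-comm c U) q) p

Tri-∣W : ∀ {d U W c} → Tri U W c → d ∣ U → d ∣ c → d ∣ W
Tri-∣W (sum-form refl) p q = ∣m+n∣m⇒∣n q p
Tri-∣W (left-form refl) p q = ∣m+n∣m⇒∣n p q
Tri-∣W (right-form refl) p q = ∣m∣n⇒∣m+n q p

-- The least of the three valuations is attained at least twice.
Balance : (i j k : ℕ) → Set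
Balance i j k = (i ≡ k × k ≤ j) ⊎ (j ≡ k × k ≤ i) ⊎ (i ≡ j × i < k)

-- A power of p dividing two of the three terms divides the third, and `val-max` turns each such
-- divisibility into an inequality of valuations.
balance : ∀ {p U W c i j k} → Prime p → Val p U i → Val p W j → Val p c k → Tri U W c → Balance i j k
balance {p} {U} {W} {c} {i} {j} {k} pp vU vW vc t with <-cmp i k
... | tri< i<k _ _ = inj₂ (inj₂ (≤-antisym i≤j j≤i , i<k))
  where
  i≤j : i ≤ j
  i≤j = val-max pp vW i (Tri-∣W t (val-∣ vU i ≤-refl) (val-∣ vc i (<⇒≤ i<k)))
  j≤i : j ≤ i
  j≤i with j ≤? i
  ... | yes p = p
  ... | no j≰i = ⊥-elim (1+n≰n (val-max pp vU (suc i)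
          (Tri-∣W (Tri-swap t) (val-∣ vW (suc i) (≰⇒> j≰i)) (val-∣ vc (suc i) i<k))))
... | tri≈ _ refl _ = inj₁ (refl , val-max pp vW i (Tri-∣W t (val-∣ vU i ≤-refl) (val-∣ vc i ≤-refl)))
... | tri> _ _ k<i = inj₂ (inj₁ (≤-antisym j≤k k≤j , <⇒≤ k<i))
  where
  k≤j : k ≤ j
  k≤j = val-max pp vW k (Tri-∣W t (val-∣ vU k (<⇒≤ k<i)) (val-∣ vc k ≤-refl))
  j≤k : j ≤ k
  j≤k with j ≤? k
  ... | yes p = p
  ... | no j≰k = ⊥-elim (1+n≰n (val-max pp vc (suc k)
          (Tri-∣c t (val-∣ vU (suc k) k<i) (val-∣ vW (suc k) (≰⇒> j≰k)))))

-- With g the gcd of α and β, take e = β / g and f = α / g. They are coprime, so every solution of i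
-- α = j β is a multiple of (e , f).
commensurable : ∀ α β → 1 ≤ α → 1 ≤ β → ∃[ e ] ∃[ f ] (1 ≤ e × 1 ≤ f × e * α ≡ f * β ×
  (∀ i j → i * α ≡ j * β → ∃[ t ] (i ≡ e * t × j ≡ f * t)))
commensurable α β 1≤α 1≤β with mkGCD α β
... | zero , G = ⊥-elim (1+n≰n (≤-trans 1≤α (≤-reflexive (0∣⇒≡0 (proj₁ (GCD.commonDivisor G))))))
... | suc g , G with GCD.commonDivisor G
...   | divides f α≡ , divides e β≡ = e , f , pos e β≡ 1≤β , pos f α≡ 1≤α , eα≡fβ , split
  where
  pos : ∀ q {n} → n ≡ q * suc g → 1 ≤ n → 1 ≤ q
  pos zero refl ()
  pos (suc q) _ _ = s≤s z≤n
  eα≡fβ : e * α ≡ f * β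
  eα≡fβ = trans (cong (e *_) α≡) (trans (rearrange (suc g)) (cong (f *_) (sym β≡)))
    where
    rearrange : ∀ g → e * (f * g) ≡ f * (e * g)
    rearrange g = solve (e ∷ f ∷ g ∷ [])
  coprime : Coprime e f
  coprime {d} (divides x e≡ , divides y f≡) =
    ∣1⇒≡1 (*-cancelʳ-∣ {d} {1} (suc g) (subst (d * suc g ∣_) (sym (+-identityʳ (suc g))) (GCD.greatest G
      ( divides y (trans α≡ (trans (cong (_* suc g) f≡) (*-assoc y d (suc g))))
      , divides x (trans β≡ (trans (cong (_* suc g) e≡) (*-assoc x d (suc g))))))))
  split : ∀ i j → i * α ≡ j * β → ∃[ t ] (i ≡ e * t × j ≡ f * t)
  split i j eq with coprime-divisor {o = i} coprime (divides j reduced)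
    where
    reduced : f * i ≡ j * e
    reduced = *-cancelʳ-≡ (f * i) (j * e) (suc g) (trans (rearrange (suc g)) (trans (cong (i *_) (sym α≡))
        (trans eq (trans (cong (j *_) β≡) (sym (*-assoc j e (suc g)))))))
      where
      rearrange : ∀ g → f * i * g ≡ i * (f * g)
      rearrange g = solve (f ∷ i ∷ g ∷ [])
  ... | divides t refl = t , *-comm t e , j≡
    where
    j≡ : j ≡ f * t
    j≡ = *-cancelʳ-≡ j (f * t) β {{>-nonZero 1≤β}} (trans (sym eq)
           (trans (*-assoc t e α) (trans (cong (t *_) eα≡fβ) (rearrange t f β))))
      where
      rearrange : ∀ t f β → t * (f * β) ≡ f * t * β
      rearrange t f β = solve (t ∷ f ∷ β ∷ [])

even-or-odd : ∀ n → 2 ∣ n ⊎ 2 ∣ suc n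
even-or-odd zero = inj₁ (divides 0 refl)
even-or-odd (suc n) with even-or-odd n
... | inj₁ d = inj₂ (∣m∣n⇒∣m+n (divides 1 refl) d)
... | inj₂ d = inj₁ d

p≤p^θ : ∀ {p θ} → Prime p → 1 ≤ θ → p ≤ p ^ θ
p≤p^θ {p} pp 1≤θ = ≤-trans (≤-reflexive (sym (^-identityʳ p)))
  (^-monoʳ-≤ p {{>-nonZero (<-trans (s≤s z≤n) (2≤prime pp))}} 1≤θ)

-- A and B are multiples of P = p ^ θ, so they differ by at least P, which suffices when P ≥ 3. When
-- P = 2, both cofactors are odd and differ by at least 2, so A and B differ by at least 4.
gap : ∀ {p A B θ} → Prime p → 1 ≤ θ → Val p A θ → Val p B θ → B < A → 3 + B ≤ A
gap {p} {A} {B} {θ} pp 1≤θ (val A′ refl p∤A′) (val B′ refl p∤B′) B<A =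
  split (p ^ θ) refl B<A
  where
  open ≤-Reasoning
  split : ∀ P → p ^ θ ≡ P → P * B′ < P * A′ → 3 + P * B′ ≤ P * A′
  split 0 _ ()
  split 1 P≡ _ = ⊥-elim (1+n≰n {1} (≤-trans (2≤prime pp) (≤-trans (p≤p^θ pp 1≤θ) (≤-reflexive P≡))))
  split P@(suc (suc (suc P′))) _ lt = begin
    3 + P * B′   ≤⟨ +-monoˡ-≤ (P * B′) (m≤m+n 3 P′) ⟩
    P + P * B′   ≡⟨ *-suc P B′ ⟨
    P * suc B′   ≤⟨ scale-≤ P (*-cancelˡ-< P B′ A′ lt) ⟩
    P * A′       ∎
  split 2 P≡ lt with m≤n⇒m<n∨m≡n (*-cancelˡ-< 2 B′ A′ lt)
  ... | inj₁ 2+B′≤A′ = begin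
    3 + 2 * B′     ≤⟨ n≤1+n _ ⟩
    4 + 2 * B′     ≡⟨ solve (B′ ∷ []) ⟩
    2 * (2 + B′)   ≤⟨ scale-≤ 2 2+B′≤A′ ⟩
    2 * A′         ∎
  ... | inj₂ refl = ⊥-elim ([ 2∤ p∤B′ , 2∤ p∤A′ ] (even-or-odd B′))
    where
    p≡2 : p ≡ 2
    p≡2 = ≤-antisym (≤-trans (p≤p^θ pp 1≤θ) (≤-reflexive P≡)) (2≤prime pp)
    2∤ : ∀ {n} → ¬ p ∣ n → 2 ∣ n → ⊥
    2∤ p∤n = subst (λ q → ¬ q ∣ _) p≡2 p∤n

val⇒∣ : ∀ {p n v} → 1 ≤ v → Val p n v → p ∣ n
val⇒∣ {p} 1≤v vn = subst (_∣ _) (^-identityʳ p) (val-∣ vn 1 1≤v)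

∣⇒val : ∀ {p n v} → p ∣ n → Val p n v → 1 ≤ v
∣⇒val {v = zero} d (val m refl p∤m) = ⊥-elim (p∤m (subst (_ ∣_) (+-identityʳ m) d))
∣⇒val {v = suc v} _ _ = s≤s z≤n

-- By `gap` only B = 2, A = 5 could fail, and then p would divide 5 - 2 * 2 = 1.
six-≤ : ∀ {p A B θ} → Prime p → 1 ≤ θ → Val p A θ → Val p B θ → 2 ≤ B → B < A → 6 ≤ A
six-≤ {p} {A} {B} pp 1≤θ vA vB 2≤B B<A with m≤n⇒m<n∨m≡n 2≤B
... | inj₁ 3≤B = ≤-trans (+-monoʳ-≤ 3 3≤B) (gap pp 1≤θ vA vB B<A)
... | inj₂ refl with m≤n⇒m<n∨m≡n (gap pp 1≤θ vA vB B<A)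
...   | inj₁ 6≤A = 6≤A
...   | inj₂ refl = ⊥-elim (1+n≰n (≤-trans (2≤prime pp) (∣⇒≤ (∣m+n∣m⇒∣n {p} {4} {1} (val⇒∣ 1≤θ vA)
          (∣-trans (val⇒∣ 1≤θ vB) (divides 2 refl))))))

-- Configurations of solutions

2≤⇒nonZero : ∀ {a} → 2 ≤ a → NonZero a
2≤⇒nonZero 2≤a = >-nonZero (<-trans (s≤s z≤n) 2≤a)

a≤a^i : ∀ {a i} → 2 ≤ a → 1 ≤ i → a ≤ a ^ i
a≤a^i {a} 2≤a 1≤i = ≤-trans (≤-reflexive (sym (^-identityʳ a))) (^-monoʳ-≤ a {{2≤⇒nonZero 2≤a}} 1≤i)

2≤a^i : ∀ {a i} → 2 ≤ a → 1 ≤ i → 2 ≤ a ^ i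
2≤a^i 2≤a 1≤i = ≤-trans 2≤a (a≤a^i 2≤a 1≤i)

2a^i≤a^j : ∀ {a i j} → 2 ≤ a → i < j → 2 * a ^ i ≤ a ^ j
2a^i≤a^j {a} {i} 2≤a i<j = ≤-trans (*-monoˡ-≤ (a ^ i) 2≤a) (^-monoʳ-≤ a {{2≤⇒nonZero 2≤a}} i<j)

i<a^i : ∀ {a} → 2 ≤ a → ∀ i → i < a ^ i
i<a^i 2≤a zero = s≤s z≤n
i<a^i {a} 2≤a (suc i) = ≤-trans (≤-trans (s≤s (i<a^i 2≤a i)) (≤-trans (+-monoˡ-≤ (a ^ i) (m^n>0 a {{2≤⇒nonZero 2≤a}} i))
   (≤-reflexive (cong (a ^ i +_) (sym (+-identityʳ (a ^ i))))))) (*-monoˡ-≤ (a ^ i) 2≤a)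

a^i≡a⇒i≡1 : ∀ {a i} → 2 ≤ a → a ^ i ≡ a → i ≡ 1
a^i≡a⇒i≡1 {a} {i} 2≤a eq with <-cmp i 1
... | tri≈ _ e _ = e
... | tri< (s≤s z≤n) _ _ = ⊥-elim (1+n≰n (≤-trans 2≤a (≤-reflexive (sym eq))))
... | tri> _ _ 1<i = ⊥-elim (<-irrefl (trans (^-identityʳ a) (sym eq)) (^-monoʳ-< a 2≤a 1<i))

-- For a numeral k ≥ 2 this list evaluates to the finitely many bases with a power equal to k, so
-- that matching on membership determines the base. Exponents below k suffice because i < a ^ i.
roots : ℕ → List ℕ
roots k = filter (λ a → any? (λ i → a ^ i ≟ k) (upTo k)) (upTo (suc k))

root-∈ : ∀ {a i k} → 2 ≤ a → 1 ≤ i → a ^ i ≡ k → a ∈ roots k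
root-∈ {a} {i} 2≤a 1≤i refl = ∈-filter⁺ (λ a′ → any? (λ i′ → a′ ^ i′ ≟ a ^ i) (upTo (a ^ i)))
  (∈-upTo⁺ (s≤s (a≤a^i 2≤a 1≤i))) (lose (∈-upTo⁺ (i<a^i 2≤a i)) refl)

-- The equation ± R A^x ± S B^y = C, with a certificate that its solutions have x, y < n: as p^m ∤ C, one of x, y is
-- below m, and this bounds the other.
record Entry : Set where
  constructor entry
  field
    A B R S C p m n : ℕ

-- e₁ is the associate of E₁; the other two match E₂ and E₃.
e₁ e₂ e₃ : Entry
e₁ = entry 2 2 3 1 4 2 3 5
e₂ = entry 2 2 1 1 3 2 1 3
e₃ = entry 6 2 1 7 8 2 4 8

-- The first six entries come from `Tie` (`tie₂` twice, since F = 4 is a power of 2 and of 4), the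
-- seventh from `inversion`, and the last from proportional solutions with A = 6, B = 3. Of the
-- exceptional ones, `e₁` is `tie₃` with a = 2, `e₂` comes from `cross`, and `e₃` from A = 6, B = 2.
three-solutions table : List Entry
three-solutions =
  entry 2 2 3 1 2 2 2 4 ∷
  entry 2 2 5 1 6 2 2 5 ∷
  entry 2 4 5 1 6 2 2 3 ∷
  entry 3 3 2 1 3 3 2 3 ∷
  entry 6 2 1 1 2 2 2 6 ∷
  entry 4 2 3 1 4 2 3 8 ∷
  entry 2 2 1 1 2 2 2 3 ∷
  entry 6 3 2 7 9 3 3 4 ∷ []
table = e₁ ∷ e₂ ∷ e₃ ∷ three-solutions

Fit : Entry → (a b U W c : ℕ) → Set
Fit e a b U W c = a ≡ A × b ≡ B × Scaled R S C U W c
  where open Entry e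

Sporadic : (a b U W c : ℕ) → Set
Sporadic a b U W c = Any (λ e → Fit e a b U W c ⊎ Fit e b a W U c) table

Sporadic-swap : ∀ {a b U W c} → Sporadic a b U W c → Sporadic b a W U c
Sporadic-swap = Any.map [ inj₂ , inj₁ ]

pattern at0 x = here (inj₁ x)
pattern at1 x = there (at0 x)
pattern at2 x = there (at1 x)
pattern at3 x = there (at2 x)
pattern at4 x = there (at3 x)
pattern at5 x = there (at4 x)
pattern at6 x = there (at5 x)
pattern at7 x = there (at6 x)
pattern at8 x = there (at7 x)
pattern at9 x = there (at8 x)
pattern at10 x = there (at9 x)

tie⇒sporadic : ∀ {a b U W c i j j′} → 2 ≤ a → 2 ≤ b → 0 < U → 0 < W → Tri U W c → 1 ≤ i → 1 ≤ j → j < j′ →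
  Tri (U * a ^ i) (W * b ^ j) c → Tri (U * a ^ i) (W * b ^ j′) c → Sporadic a b U W c
tie⇒sporadic {a} {b} {U} {W} {c} {i} {j} {j′} 2≤a 2≤b 0<U 0<W t₀ 1≤i 1≤j j<j′ t₁ t₂
  with tie 0<U 0<W t₀ (2≤a^i 2≤a 1≤i) (2≤a^i 2≤b 1≤j) (2≤a^i 2≤b (m<n⇒0<n∸m j<j′)) common t₁
         (subst (λ z → Tri (U * a ^ i) (W * z) c) b^j′≡ t₂)
  where
  b^j′≡ : b ^ j′ ≡ b ^ j * b ^ (j′ ∸ j)
  b^j′≡ = trans (cong (b ^_) (sym (m+[n∸m]≡n (<⇒≤ j<j′)))) (^-distribˡ-+-* b j (j′ ∸ j))
  b∣ : ∀ {k} → 1 ≤ k → b ∣ b ^ k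
  b∣ {suc k} _ = m∣m*n (b ^ k)
  -- Both exponents are positive, so b itself is a common divisor.
  common : ¬ gcd (b ^ j) (b ^ (j′ ∸ j)) ≡ 1
  common eq = 1+n≰n (≤-trans 2≤b (∣⇒≤ (subst (b ∣_) eq (gcd-greatest (b∣ 1≤j) (b∣ (m<n⇒0<n∸m j<j′))))))
... | R , S , C , T , sc = finish T refl refl sc
  where
  finish : ∀ {X F R S C} → Tie X F R S C → a ^ i ≡ X → b ^ (j′ ∸ j) ≡ F → Scaled R S C U W c → Sporadic a b U W c
  -- `roots 4` consists of 2 and 4, while `roots` of 2, 3 and 6 are singletons; this is why `tie₂`
  -- and `tie₃` each split in two.
  finish T p q sc with root-∈ 2≤a 1≤i p | root-∈ 2≤b (m<n⇒0<n∸m j<j′) q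
  finish tie₁ _ _ sc | here refl | here refl = at3 (refl , refl , sc)
  finish tie₂ _ _ sc | here refl | here refl = at4 (refl , refl , sc)
  finish tie₂ _ _ sc | here refl | there (here refl) = at5 (refl , refl , sc)
  finish tie₃ _ _ sc | here refl | here refl = at0 (refl , refl , sc)
  finish tie₃ _ _ sc | there (here refl) | here refl = at8 (refl , refl , sc)
  finish tie₄ _ _ sc | here refl | here refl = at7 (refl , refl , sc)
  finish tie₅ _ _ sc | here refl | here refl = at6 (refl , refl , sc)

inversion⇒sporadic : ∀ {a b U W c i i′ j j′} → 2 ≤ a → 2 ≤ b → 0 < U → 0 < W → Tri U W c → 1 ≤ i → 1 ≤ j →
  i < i′ → j < j′ → Tri (U * a ^ i) (W * b ^ j′) c → Tri (U * a ^ i′) (W * b ^ j) c → Sporadic a b U W c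
inversion⇒sporadic 2≤a 2≤b 0<U 0<W t₀ 1≤i 1≤j i<i′ j<j′ t₁ t₂
  with X≡2 , Y≡2 , sc ← inversion 0<U 0<W (Tri⇒c≤ t₀) (2≤a^i 2≤a 1≤i) (2≤a^i 2≤b 1≤j)
                          (2a^i≤a^j 2≤a i<i′) (2a^i≤a^j 2≤b j<j′) t₁ t₂
  with root-∈ 2≤a 1≤i X≡2 | root-∈ 2≤b 1≤j Y≡2
... | here refl | here refl = at9 (refl , refl , sc)

cross-ordered : ∀ {a b U W c i i′ j j′} → 2 ≤ a → 2 ≤ b → 0 < U → 0 < W → U ≤ W → 1 ≤ i → 1 ≤ j → i < i′ → j < j′ →
  Tri U (W * b ^ j) c → Tri U (W * b ^ j′) c → Tri (U * a ^ i) W c → Tri (U * a ^ i′) W c → Sporadic a b U W c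
cross-ordered {a} 2≤a 2≤b 0<U 0<W U≤W 1≤i 1≤j i<i′ j<j′ t₁ t₂ s₁ s₂
  with Y≡2 , X≡2 , sc ← cross 0<U 0<W U≤W (2≤a^i 2≤b 1≤j) (2a^i≤a^j 2≤b j<j′)
                          (λ eq → <-irrefl eq (^-monoʳ-< a 2≤a i<i′)) t₁ t₂ s₁ s₂
  with [ root-∈ 2≤a 1≤i , root-∈ 2≤a (≤-trans 1≤i (<⇒≤ i<i′)) ]′ X≡2 | root-∈ 2≤b 1≤j Y≡2
... | here refl | here refl = at1 (refl , refl , sc)

cross⇒sporadic : ∀ {a b U W c i i′ j j′} → 2 ≤ a → 2 ≤ b → 0 < U → 0 < W → 1 ≤ i → 1 ≤ j → i < i′ → j < j′ →
  Tri U (W * b ^ j) c → Tri U (W * b ^ j′) c → Tri (U * a ^ i) W c → Tri (U * a ^ i′) W c → Sporadic a b U W c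
cross⇒sporadic {a} {b} {U} {W} 2≤a 2≤b 0<U 0<W 1≤i 1≤j i<i′ j<j′ t₁ t₂ s₁ s₂ with ≤-total U W
... | inj₁ U≤W = cross-ordered 2≤a 2≤b 0<U 0<W U≤W 1≤i 1≤j i<i′ j<j′ t₁ t₂ s₁ s₂
... | inj₂ W≤U = Sporadic-swap {b} {a} {W} {U} (cross-ordered 2≤b 2≤a 0<W 0<U W≤U 1≤j 1≤i j<j′ i<i′
                   (Tri-swap s₁) (Tri-swap s₂) (Tri-swap t₁) (Tri-swap t₂))

-- This excludes A = B. Both solutions would read (U - W) X = c up to sign; the sign is that of U -
-- W in both, so X would be determined.
distinct-bases : ∀ {U W c X₁ X₂} → 0 < U → 0 < c → c ≤ U + W → 2 ≤ X₁ → X₁ < X₂ →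
  Tri (U * X₁) (W * X₁) c → Tri (U * X₂) (W * X₂) c → ⊥
distinct-bases {U} {W} {c} {X₁} {X₂} 0<U 0<c c≤ 2≤X₁ X₁<X₂ t₁ t₂ =
  clash (difference 0<U c≤ 2≤X₁ 2≤X₁ t₁) (difference 0<U c≤ 2≤X₂ 2≤X₂ t₂)
  where
  2≤X₂ : 2 ≤ X₂
  2≤X₂ = ≤-trans 2≤X₁ (<⇒≤ X₁<X₂)
  exceed : ∀ {U W X} → U * X ≡ c + W * X → W < U
  exceed {U} {W} {X} e = *-cancelʳ-< X W U (≤-trans (+-monoˡ-≤ (W * X) 0<c) (≤-reflexive (sym e)))
  same : ∀ {U W} → U * X₁ ≡ c + W * X₁ → U * X₂ ≡ c + W * X₂ → ⊥
  same {U} {W} d₁ d₂ = scaled (U ∸ W) (m<n⇒0<n∸m W<U) (sym (m+[n∸m]≡n (<⇒≤ W<U)))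
    where
    W<U : W < U
    W<U = exceed {U} {W} {X₁} d₁
    scaled : ∀ k → 0 < k → U ≡ W + k → ⊥
    scaled k 0<k refl = <-irrefl (*-cancelˡ-≡ X₁ X₂ k {{>-nonZero 0<k}}
      (trans (c≡ d₁) (sym (c≡ d₂)))) X₁<X₂
      where
      c≡ : ∀ {X} → (W + k) * X ≡ c + W * X → k * X ≡ c
      c≡ {X} e = cancel-≡ e (W * X) (solve (W ∷ k ∷ X ∷ [])) (solve (W ∷ c ∷ X ∷ []))
  clash : Difference (U * X₁) (W * X₁) c → Difference (U * X₂) (W * X₂) c → ⊥
  clash (inj₁ d₁) (inj₁ d₂) = same {U} {W} d₁ d₂
  clash (inj₂ d₁) (inj₂ d₂) = same {W} {U} d₁ d₂
  clash (inj₁ d₁) (inj₂ d₂) = <-asym (exceed {U} {W} {X₁} d₁) (exceed {W} {U} {X₂} d₂)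
  clash (inj₂ d₁) (inj₁ d₂) = <-asym (exceed {W} {U} {X₁} d₁) (exceed {U} {W} {X₂} d₂)

-- (B / A)ᵗ ≤ B / A, in the cross-multiplied form that `growth` takes.
power-ratio : ∀ {A B} → B ≤ A → ∀ t → 1 ≤ t → B ^ t * A ≤ A ^ t * B
power-ratio {A} {B} B≤A (suc t) _ = cast-≤ (*-mono-≤ (^-monoˡ-≤ t B≤A) (≤-refl {A * B}))
  (left (B ^ t)) (right (A ^ t))
  where
  left : ∀ P → P * (A * B) ≡ B * P * A
  left P = solve (P ∷ A ∷ B ∷ [])
  right : ∀ P → P * (A * B) ≡ A * P * B
  right P = solve (P ∷ A ∷ B ∷ [])

-- `growth` returns A = Aᵈ = 6 and Bᵗ = B, so t = d = 1 and the solutions have exponents 1 and 2 in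
-- A and B. As 6, 2 and 3 are not perfect powers, a = A and b = B.
parallel : ∀ {p a b U W c e f t t′ θ} → Prime p → 1 ≤ θ → Val p (a ^ e) θ → Val p (b ^ f) θ →
  2 ≤ a → 2 ≤ b → 1 ≤ e → 1 ≤ f → 0 < U → 0 < W → Tri U W c → 1 ≤ t → t < t′ → b ^ f < a ^ e →
  Tri (U * (a ^ e) ^ t) (W * (b ^ f) ^ t) c → Tri (U * (a ^ e) ^ t′) (W * (b ^ f) ^ t′) c → Sporadic a b U W c
parallel {p} {a} {b} {U} {W} {c} {e} {f} {t} {t′} pp 1≤θ vA vB 2≤a 2≤b 1≤e 1≤f 0<U 0<W t₀ 1≤t t<t′ B<A t₁ t₂ =
  conclude (growth (<-trans (s≤s z≤n) (2≤a^i 2≤A 1≤t)) 2≤B (gap pp 1≤θ vA vB B<A) (six-≤ pp 1≤θ vA vB 2≤B B<A)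
    (a≤a^i 2≤B 1≤t) (a≤a^i 2≤A 1≤d) (power-ratio (<⇒≤ B<A) d 1≤d) (power-ratio (<⇒≤ B<A) t 1≤t)
    (ratio-bound 0<U 0<W c≤ (<-trans (s≤s z≤n) (2≤a^i 2≤B 1≤t)) (*-mono-< {0} {A ^ t} {0} {A ^ d}
      (<-trans (s≤s z≤n) (2≤a^i 2≤A 1≤t)) (<-trans (s≤s z≤n) (2≤a^i 2≤A 1≤d))) t₁ t₂′))
  where
  A B d : ℕ
  A = a ^ e
  B = b ^ f
  d = t′ ∸ t
  1≤d : 1 ≤ d
  1≤d = m<n⇒0<n∸m t<t′
  2≤A : 2 ≤ A
  2≤A = 2≤a^i 2≤a 1≤e
  2≤B : 2 ≤ B
  2≤B = 2≤a^i 2≤b 1≤f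
  c≤ : c ≤ U + W
  c≤ = Tri⇒c≤ t₀
  ^t′≡ : ∀ n → n ^ t′ ≡ n ^ t * n ^ d
  ^t′≡ n = trans (cong (n ^_) (sym (m+[n∸m]≡n (<⇒≤ t<t′)))) (^-distribˡ-+-* n t d)
  t₂′ : Tri (U * (A ^ t * A ^ d)) (W * (B ^ t * B ^ d)) c
  t₂′ = subst₂ (λ x y → Tri (U * x) (W * y) c) (^t′≡ A) (^t′≡ B) t₂
  conclude : A ≡ 6 × A ^ d ≡ 6 × B ^ t ≡ B × (B ≡ 2 ⊎ B ≡ 3) → Sporadic a b U W c
  conclude (A≡6 , A^d≡6 , B^t≡B , B≡) = finish B≡ (root-∈ 2≤a 1≤e A≡6)
    where
    t≡1 : t ≡ 1
    t≡1 = a^i≡a⇒i≡1 2≤B B^t≡B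
    d≡1 : d ≡ 1
    d≡1 = a^i≡a⇒i≡1 2≤A (trans A^d≡6 (sym A≡6))
    first : ∀ {k} → B ≡ k → Tri (U * 6) (W * k) c
    first B≡k = subst₂ (λ x y → Tri (U * x) (W * y) c) (trans (cong (A ^_) t≡1) (trans (^-identityʳ A) A≡6))
                  (trans B^t≡B B≡k) t₁
    second : ∀ {k} → B ≡ k → Tri (U * 36) (W * (k * k)) c
    second B≡k = subst₂ (λ x y → Tri (U * x) (W * y) c)
      (cong₂ _*_ (trans (cong (A ^_) t≡1) (trans (^-identityʳ A) A≡6)) A^d≡6)
      (cong₂ _*_ (trans B^t≡B B≡k) (trans (cong (B ^_) d≡1) (trans (^-identityʳ B) B≡k))) t₂′
    finish : B ≡ 2 ⊎ B ≡ 3 → a ∈ roots 6 → Sporadic a b U W c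
    finish (inj₁ B≡2) (here refl) with root-∈ 2≤b 1≤f B≡2
    ... | here refl = at2 (refl , refl , scaled-6-2 0<U c≤ (first B≡2) (second B≡2))
    finish (inj₂ B≡3) (here refl) with root-∈ 2≤b 1≤f B≡3
    ... | here refl = at10 (refl , refl , scaled-6-3 0<U c≤ (first B≡3) (second B≡3))

-- Equal p-adic valuations of `a ^ i` and `b ^ j` make (i , j) a multiple of one primitive pair (e ,
-- f). Both solutions thus have equal exponents in A = aᵉ and B = bᶠ, and A and B have the same
-- valuation.
chain⇒sporadic : ∀ {p a b U W c α β i i′ j j′} → Prime p → Val p a α → Val p b β → 1 ≤ α → 1 ≤ β →
  2 ≤ a → 2 ≤ b → 0 < U → 0 < W → 0 < c → Tri U W c → 1 ≤ i → i < i′ → i * α ≡ j * β → i′ * α ≡ j′ * β →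
  Tri (U * a ^ i) (W * b ^ j) c → Tri (U * a ^ i′) (W * b ^ j′) c → Sporadic a b U W c
chain⇒sporadic {p} {a} {b} {U} {W} {c} {α} {β} {i} {i′} {j} {j′} pp va vb 1≤α 1≤β 2≤a 2≤b 0<U 0<W 0<c t₀ 1≤i i<i′ eq eq′ t₁ t₂
  with e , f , 1≤e , 1≤f , eα≡fβ , split ← commensurable α β 1≤α 1≤β
  with t , refl , refl ← split i j eq | t′ , refl , refl ← split i′ j′ eq′ = trichotomy
  where
  A B : ℕ
  A = a ^ e
  B = b ^ f
  vA : Val p A (e * α)
  vA = val-^ pp va e
  vB : Val p B (e * α)
  vB = subst (Val p B) (sym eα≡fβ) (val-^ pp vb f)
  1≤θ : 1 ≤ e * α
  1≤θ = *-mono-≤ 1≤e 1≤α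
  1≤t : 1 ≤ t
  1≤t = n≢0⇒n>0 λ { refl → 1+n≰n (≤-trans 1≤i (≤-reflexive (*-zeroʳ e))) }
  t<t′ : t < t′
  t<t′ = *-cancelˡ-< e t t′ i<i′
  T₁ : Tri (U * A ^ t) (W * B ^ t) c
  T₁ = subst₂ (λ x y → Tri (U * x) (W * y) c) (sym (^-*-assoc a e t)) (sym (^-*-assoc b f t)) t₁
  T₂ : Tri (U * A ^ t′) (W * B ^ t′) c
  T₂ = subst₂ (λ x y → Tri (U * x) (W * y) c) (sym (^-*-assoc a e t′)) (sym (^-*-assoc b f t′)) t₂
  trichotomy : Sporadic a b U W c
  trichotomy with <-cmp A B
  ... | tri> _ _ B<A = parallel pp 1≤θ vA vB 2≤a 2≤b 1≤e 1≤f 0<U 0<W t₀ 1≤t t<t′ B<A T₁ T₂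
  ... | tri< A<B _ _ = Sporadic-swap {b} {a} {W} {U} (parallel pp 1≤θ vB vA 2≤b 2≤a 1≤f 1≤e 0<W 0<U (Tri-swap t₀) 1≤t t<t′ A<B
                         (Tri-swap T₁) (Tri-swap T₂))
  ... | tri≈ _ A≡B _ = ⊥-elim (distinct-bases 0<U 0<c (Tri⇒c≤ t₀) (2≤a^i (2≤a^i 2≤a 1≤e) 1≤t)
        (^-monoʳ-< A (2≤a^i 2≤a 1≤e) t<t′)
        (subst (λ z → Tri (U * A ^ t) (W * z ^ t) c) (sym A≡B) T₁)
        (subst (λ z → Tri (U * A ^ t′) (W * z ^ t′) c) (sym A≡B) T₂))

-- Four solutions, sorted by valuation

open import Data.List.Relation.Unary.All as All using (All; []; _∷_; all?)
open import Data.List.Relation.Unary.AllPairs using ([]; _∷_)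

-- Given U and c, the other term can only be the absolute difference of U and c (`Below`) or their
-- sum (`Over`). The two forms of `Below` can hold together only when both terms are 0.
third-equal : ∀ {U W₁ W₂ W₃ c} → Tri U W₁ c → Tri U W₂ c → Tri U W₃ c → W₁ ≡ W₂ ⊎ W₁ ≡ W₃ ⊎ W₂ ≡ W₃
third-equal {U} {W₁} {W₂} {W₃} {c} t₁ t₂ t₃ = go (class t₁) (class t₂) (class t₃)
  where
  Below Over : ℕ → Set
  Below W = (U + W ≡ c) ⊎ (U ≡ c + W)
  Over W = W ≡ c + U
  class : ∀ {W} → Tri U W c → Below W ⊎ Over W
  class (sum-form e) = inj₁ (inj₁ e)
  class (left-form e) = inj₁ (inj₂ e)
  class (right-form e) = inj₂ e
  mixed : ∀ {W W′} → U + W ≡ c → U ≡ c + W′ → W ≡ W′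
  mixed {W} {W′} refl e =
    trans (m+n≡0⇒m≡0 W zeros) (sym (m+n≡0⇒n≡0 W zeros))
    where
    zeros : W + W′ ≡ 0
    zeros = cancel-≡ (sym e) U (+-assoc U W W′) (sym (+-identityʳ U))
  below : ∀ {W W′} → Below W → Below W′ → W ≡ W′
  below (inj₁ e) (inj₁ f) = +-cancelˡ-≡ U _ _ (trans e (sym f))
  below (inj₁ e) (inj₂ f) = mixed e f
  below (inj₂ e) (inj₁ f) = sym (mixed f e)
  below (inj₂ e) (inj₂ f) = +-cancelˡ-≡ c _ _ (trans (sym e) f)
  go : Below W₁ ⊎ Over W₁ → Below W₂ ⊎ Over W₂ → Below W₃ ⊎ Over W₃ → W₁ ≡ W₂ ⊎ W₁ ≡ W₃ ⊎ W₂ ≡ W₃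
  go (inj₁ e) (inj₁ f) _ = inj₁ (below e f)
  go (inj₂ e) (inj₂ f) _ = inj₁ (trans e (sym f))
  go (inj₁ e) (inj₂ f) (inj₁ g) = inj₂ (inj₁ (below e g))
  go (inj₁ e) (inj₂ f) (inj₂ g) = inj₂ (inj₂ (trans f (sym g)))
  go (inj₂ e) (inj₁ f) (inj₁ g) = inj₂ (inj₂ (below f g))
  go (inj₂ e) (inj₁ f) (inj₂ g) = inj₂ (inj₁ (trans e (sym g)))

scaled-power-injective : ∀ {s b y y′} → 0 < s → 2 ≤ b → s * b ^ y ≡ s * b ^ y′ → y ≡ y′
scaled-power-injective {s} {b} {y} {y′} 0<s 2≤b eq with <-cmp y y′
... | tri≈ _ e _ = e
... | tri< lt _ _ = ⊥-elim (<-irrefl eq (*-monoʳ-< s {{>-nonZero 0<s}} (^-monoʳ-< b 2≤b lt)))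
... | tri> _ _ lt = ⊥-elim (<-irrefl (sym eq) (*-monoʳ-< s {{>-nonZero 0<s}} (^-monoʳ-< b 2≤b lt)))

Point : Set
Point = ℕ × ℕ

three-others : ∀ {L : List Point} {q} → Unique L → 4 ≤ length L → q ∈ L →
  ∃[ q₁ ] ∃[ q₂ ] ∃[ q₃ ] (q₁ ∈ L × q₂ ∈ L × q₃ ∈ L × q₁ ≢ q × q₂ ≢ q × q₃ ≢ q × q₁ ≢ q₂ × q₁ ≢ q₃ × q₂ ≢ q₃)
three-others {w ∷ x ∷ y ∷ z ∷ L} ((wx ∷ wy ∷ wz ∷ w∉) ∷ (xy ∷ xz ∷ x∉) ∷ (yz ∷ y∉) ∷ _) _ q∈ = go q∈
  where
  W = here refl
  X = there (here refl)
  Y = there (there (here refl))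
  Z = there (there (there (here refl)))
  go : ∀ {q} → q ∈ (w ∷ x ∷ y ∷ z ∷ L) → ∃[ q₁ ] ∃[ q₂ ] ∃[ q₃ ] (q₁ ∈ (w ∷ x ∷ y ∷ z ∷ L) × q₂ ∈ (w ∷ x ∷ y ∷ z ∷ L)
       × q₃ ∈ (w ∷ x ∷ y ∷ z ∷ L) × q₁ ≢ q × q₂ ≢ q × q₃ ≢ q × q₁ ≢ q₂ × q₁ ≢ q₃ × q₂ ≢ q₃)
  go (here refl) = x , y , z , X , Y , Z , ≢-sym wx , ≢-sym wy , ≢-sym wz , xy , xz , yz
  go (there (here refl)) = w , y , z , W , Y , Z , wx , ≢-sym xy , ≢-sym xz , wy , wz , yz
  go (there (there (here refl))) = w , x , z , W , X , Z , wy , xy , ≢-sym yz , wx , wz , xz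
  go (there (there (there (here refl)))) = w , x , y , W , X , Y , wz , xz , yz , wx , wy , xy
  go (there (there (there (there q∈)))) = w , x , y , W , X , Y , All.lookup w∉ q∈ , All.lookup x∉ q∈ , All.lookup y∉ q∈ , wx , wy , xy
three-others {[]} _ () _
three-others {_ ∷ []} _ (s≤s ()) _
three-others {_ ∷ _ ∷ []} _ (s≤s (s≤s ())) _
three-others {_ ∷ _ ∷ _ ∷ []} _ (s≤s (s≤s (s≤s ()))) _

module Solutions {a b c r s : ℕ} (2≤a : 2 ≤ a) (2≤b : 2 ≤ b) (0<c : 0 < c) (0<r : 0 < r) (0<s : 0 < s)
  {p : ℕ} (pp : Prime p) {α β ρ σ γ : ℕ}
  (va : Val p a α) (vb : Val p b β) (vr : Val p r ρ) (vs : Val p s σ) (vc : Val p c γ)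
  (1≤α : 1 ≤ α) (1≤β : 1 ≤ β) where

  instance
    a≢0 : NonZero a
    a≢0 = 2≤⇒nonZero 2≤a
    b≢0 : NonZero b
    b≢0 = 2≤⇒nonZero 2≤b
    α≢0 : NonZero α
    α≢0 = >-nonZero 1≤α
    β≢0 : NonZero β
    β≢0 = >-nonZero 1≤β

  U W vU vW : ℕ → ℕ
  U x = r * a ^ x
  W y = s * b ^ y
  vU x = ρ + x * α
  vW y = σ + y * β

  0<U : ∀ x → 0 < U x
  0<U x = *-mono-≤ 0<r (m^n>0 a x)

  0<W : ∀ y → 0 < W y
  0<W y = *-mono-≤ 0<s (m^n>0 b y)

  Solution X-type Y-type Low : Point → Set
  Solution (x , y) = Tri (U x) (W y) c
  X-type (x , y) = vU x ≡ γ × γ ≤ vW y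
  Y-type (x , y) = vW y ≡ γ × γ ≤ vU x
  Low (x , y) = vU x ≡ vW y × vU x < γ

  classify : ∀ q → Solution q → X-type q ⊎ Y-type q ⊎ Low q
  classify (x , y) = balance pp (val-* pp vr (val-^ pp va x)) (val-* pp vs (val-^ pp vb y)) vc

  U-shift : ∀ {x x′} → x ≤ x′ → U x′ ≡ U x * a ^ (x′ ∸ x)
  U-shift {x} {x′} x≤x′ = trans (cong (r *_) (trans (cong (a ^_) (sym (m+[n∸m]≡n x≤x′)))
    (^-distribˡ-+-* a x (x′ ∸ x)))) (sym (*-assoc r (a ^ x) _))

  W-shift : ∀ {y y′} → y ≤ y′ → W y′ ≡ W y * b ^ (y′ ∸ y)
  W-shift {y} {y′} y≤y′ = trans (cong (s *_) (trans (cong (b ^_) (sym (m+[n∸m]≡n y≤y′)))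
    (^-distribˡ-+-* b y (y′ ∸ y)))) (sym (*-assoc s (b ^ y) _))

  vU-cancel-< : ∀ {x x′} → vU x < vU x′ → x < x′
  vU-cancel-< {x} {x′} lt = *-cancelʳ-< α x x′ (+-cancelˡ-< ρ _ _ lt)

  vW-cancel-< : ∀ {y y′} → vW y < vW y′ → y < y′
  vW-cancel-< {y} {y′} lt = *-cancelʳ-< β y y′ (+-cancelˡ-< σ _ _ lt)

  vU-mono-< : ∀ {x x′} → x < x′ → vU x < vU x′
  vU-mono-< lt = +-monoʳ-< ρ (*-monoˡ-< α lt)

  vW-mono-< : ∀ {y y′} → y < y′ → vW y < vW y′
  vW-mono-< lt = +-monoʳ-< σ (*-monoˡ-< β lt)

  vU-injective : ∀ {x x′} → vU x ≡ vU x′ → x ≡ x′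
  vU-injective {x} {x′} eq = *-cancelʳ-≡ x x′ α (+-cancelˡ-≡ ρ _ _ eq)

  vW-injective : ∀ {y y′} → vW y ≡ vW y′ → y ≡ y′
  vW-injective {y} {y′} eq = *-cancelʳ-≡ y y′ β (+-cancelˡ-≡ σ _ _ eq)

  -- The valuation fixes x on all X-type solutions, and `third-equal` then leaves at most two values
  -- of y.
  no-three-X : ∀ {q₁ q₂ q₃} → Solution q₁ → Solution q₂ → Solution q₃ → q₁ ≢ q₂ → q₁ ≢ q₃ → q₂ ≢ q₃ →
    X-type q₁ → X-type q₂ → X-type q₃ → ⊥
  no-three-X {x₁ , _} {x₂ , _} {x₃ , _} t₁ t₂ t₃ d₁₂ d₁₃ d₂₃ (e₁ , _) (e₂ , _) (e₃ , _)
    with vU-injective {x₁} {x₂} (trans e₁ (sym e₂)) | vU-injective {x₁} {x₃} (trans e₁ (sym e₃))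
  ... | refl | refl with third-equal t₁ t₂ t₃
  ...   | inj₁ e = d₁₂ (cong (x₁ ,_) (scaled-power-injective 0<s 2≤b e))
  ...   | inj₂ (inj₁ e) = d₁₃ (cong (x₁ ,_) (scaled-power-injective 0<s 2≤b e))
  ...   | inj₂ (inj₂ e) = d₂₃ (cong (x₁ ,_) (scaled-power-injective 0<s 2≤b e))

  no-three-Y : ∀ {q₁ q₂ q₃} → Solution q₁ → Solution q₂ → Solution q₃ → q₁ ≢ q₂ → q₁ ≢ q₃ → q₂ ≢ q₃ →
    Y-type q₁ → Y-type q₂ → Y-type q₃ → ⊥
  no-three-Y {_ , y₁} {_ , y₂} {_ , y₃} t₁ t₂ t₃ d₁₂ d₁₃ d₂₃ (e₁ , _) (e₂ , _) (e₃ , _)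
    with vW-injective {y₁} {y₂} (trans e₁ (sym e₂)) | vW-injective {y₁} {y₃} (trans e₁ (sym e₃))
  ... | refl | refl with third-equal (Tri-swap t₁) (Tri-swap t₂) (Tri-swap t₃)
  ...   | inj₁ e = d₁₂ (cong (_, y₁) (scaled-power-injective 0<r 2≤a e))
  ...   | inj₂ (inj₁ e) = d₁₃ (cong (_, y₁) (scaled-power-injective 0<r 2≤a e))
  ...   | inj₂ (inj₂ e) = d₂₃ (cong (_, y₁) (scaled-power-injective 0<r 2≤a e))

  Dominates : Point → Point → Set
  Dominates (x₀ , y₀) (x , y) = x₀ ≤ x × y₀ ≤ y

  -- The point (x₀ , y₀) serves as a new origin and need not be a solution: in a cross it is where
  -- the two lines meet.
  Based : List Point → Set
  Based L = ∃[ x₀ ] ∃[ y₀ ] (All (Dominates (x₀ , y₀)) L × Sporadic a b (U x₀) (W y₀) c)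

  high-dominates : ∀ {x₀ y₀ q} → vU x₀ ≡ γ → vW y₀ ≡ γ → X-type q ⊎ Y-type q → Dominates (x₀ , y₀) q
  high-dominates {x₀} {y₀} {x , y} eU eW t = ≮⇒≥ (λ lt → <⇒≱ (vU-mono-< lt) (subst (_≤ vU x) (sym eU) (proj₁ (γ≤ t)))) ,
                                            ≮⇒≥ (λ lt → <⇒≱ (vW-mono-< lt) (subst (_≤ vW y) (sym eW) (proj₂ (γ≤ t))))
    where
    γ≤ : X-type (x , y) ⊎ Y-type (x , y) → γ ≤ vU x × γ ≤ vW y
    γ≤ (inj₁ (e , le)) = ≤-reflexive (sym e) , le
    γ≤ (inj₂ (e , le)) = le , ≤-reflexive (sym e)

  crossing : ∀ {x₀ y₀ x₁ x₂ y₁ y₂} → x₀ < x₁ → x₁ < x₂ → y₀ < y₁ → y₁ < y₂ →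
    Solution (x₀ , y₁) → Solution (x₀ , y₂) → Solution (x₁ , y₀) → Solution (x₂ , y₀) → Sporadic a b (U x₀) (W y₀) c
  crossing {x₀} {y₀} x₀<x₁ x₁<x₂ y₀<y₁ y₁<y₂ t₁ t₂ s₁ s₂ =
    cross⇒sporadic 2≤a 2≤b (0<U x₀) (0<W y₀) (m<n⇒0<n∸m x₀<x₁) (m<n⇒0<n∸m y₀<y₁)
      (∸-monoˡ-< x₁<x₂ (<⇒≤ x₀<x₁)) (∸-monoˡ-< y₁<y₂ (<⇒≤ y₀<y₁))
      (subst (λ z → Tri (U x₀) z c) (W-shift (<⇒≤ y₀<y₁)) t₁)
      (subst (λ z → Tri (U x₀) z c) (W-shift (<⇒≤ (<-trans y₀<y₁ y₁<y₂))) t₂)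
      (subst (λ z → Tri z (W y₀) c) (U-shift (<⇒≤ x₀<x₁)) s₁)
      (subst (λ z → Tri z (W y₀) c) (U-shift (<⇒≤ (<-trans x₀<x₁ x₁<x₂))) s₂)

  -- The X-type solutions lie on a line x = x₀ and the Y-type ones on y = y₀, with both valuations
  -- equal to γ at the crossing. An X-type solution with y = y₀ would be a third Y-type one, and
  -- conversely, so all four lie strictly beyond the crossing, as `cross` requires.
  two-and-two : ∀ {L q₁ q₂ q₃ q₄} → All (λ q → X-type q ⊎ Y-type q) L →
    Solution q₁ → Solution q₂ → Solution q₃ → Solution q₄ →
    q₁ ≢ q₂ → q₁ ≢ q₃ → q₁ ≢ q₄ → q₂ ≢ q₃ → q₂ ≢ q₄ → q₃ ≢ q₄ →
    X-type q₁ → X-type q₂ → Y-type q₃ → Y-type q₄ → Based L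
  two-and-two {L} {x₀ , y₁} {x₀′ , y₂} {x₁ , y₀} {x₂ , y₀′} high t₁ t₂ t₃ t₄ d₁₂ d₁₃ d₁₄ d₂₃ d₂₄ d₃₄
      X₁@(e₁ , le₁) X₂@(e₂ , le₂) Y₃@(e₃ , le₃) Y₄@(e₄ , le₄)
    with vU-injective {x₀} {x₀′} (trans e₁ (sym e₂)) | vW-injective {y₀} {y₀′} (trans e₃ (sym e₄))
  ... | refl | refl = x₀ , y₀ , All.map (high-dominates e₁ e₃) high , order (<-cmp x₁ x₂) (<-cmp y₁ y₂)
    where
    y₀<y₁ : y₀ < y₁
    y₀<y₁ = vW-cancel-< (subst (_< vW y₁) (sym e₃) (≤∧≢⇒< le₁ λ e →
      no-three-Y t₁ t₃ t₄ d₁₃ d₁₄ d₃₄ (sym e , ≤-reflexive (sym e₁)) Y₃ Y₄))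
    y₀<y₂ : y₀ < y₂
    y₀<y₂ = vW-cancel-< (subst (_< vW y₂) (sym e₃) (≤∧≢⇒< le₂ λ e →
      no-three-Y t₂ t₃ t₄ d₂₃ d₂₄ d₃₄ (sym e , ≤-reflexive (sym e₁)) Y₃ Y₄))
    x₀<x₁ : x₀ < x₁
    x₀<x₁ = vU-cancel-< (subst (_< vU x₁) (sym e₁) (≤∧≢⇒< le₃ λ e →
      no-three-X t₁ t₂ t₃ d₁₂ d₁₃ d₂₃ X₁ X₂ (sym e , ≤-reflexive (sym e₃))))
    x₀<x₂ : x₀ < x₂
    x₀<x₂ = vU-cancel-< (subst (_< vU x₂) (sym e₁) (≤∧≢⇒< le₄ λ e →
      no-three-X t₁ t₂ t₄ d₁₂ d₁₄ d₂₄ X₁ X₂ (sym e , ≤-reflexive (sym e₃))))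
    order : Tri₃ (x₁ < x₂) (x₁ ≡ x₂) (x₂ < x₁) → Tri₃ (y₁ < y₂) (y₁ ≡ y₂) (y₂ < y₁) → Sporadic a b (U x₀) (W y₀) c
    order (tri≈ _ refl _) _ = ⊥-elim (d₃₄ refl)
    order (tri< _ _ _) (tri≈ _ refl _) = ⊥-elim (d₁₂ refl)
    order (tri> _ _ _) (tri≈ _ refl _) = ⊥-elim (d₁₂ refl)
    order (tri< x< _ _) (tri< y< _ _) = crossing x₀<x₁ x< y₀<y₁ y< t₁ t₂ t₃ t₄
    order (tri< x< _ _) (tri> _ _ y<) = crossing x₀<x₁ x< y₀<y₂ y< t₂ t₁ t₃ t₄
    order (tri> _ _ x<) (tri< y< _ _) = crossing x₀<x₂ x< y₀<y₁ y< t₁ t₂ t₄ t₃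
    order (tri> _ _ x<) (tri> _ _ y<) = crossing x₀<x₂ x< y₀<y₂ y< t₂ t₁ t₄ t₃

  no-low : ∀ {L} → Unique L → 4 ≤ length L → All Solution L → All (λ q → X-type q ⊎ Y-type q) L → Based L
  no-low {w ∷ x ∷ y ∷ z ∷ L} ((wx ∷ wy ∷ wz ∷ _) ∷ (xy ∷ xz ∷ _) ∷ (yz ∷ _) ∷ _) _
      (tw ∷ tx ∷ ty ∷ tz ∷ _) high@(hw ∷ hx ∷ hy ∷ hz ∷ _) = go hw hx hy hz
    where
    xw = ≢-sym wx
    yw = ≢-sym wy
    zw = ≢-sym wz
    yx = ≢-sym xy
    zx = ≢-sym xz
    zy = ≢-sym yz
    go : X-type w ⊎ Y-type w → X-type x ⊎ Y-type x → X-type y ⊎ Y-type y → X-type z ⊎ Y-type z → Based (w ∷ x ∷ y ∷ z ∷ L)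
    go (inj₁ p) (inj₁ q) (inj₁ r) _ = ⊥-elim (no-three-X tw tx ty wx wy xy p q r)
    go (inj₁ p) (inj₁ q) _ (inj₁ r) = ⊥-elim (no-three-X tw tx tz wx wz xz p q r)
    go (inj₁ p) _ (inj₁ q) (inj₁ r) = ⊥-elim (no-three-X tw ty tz wy wz yz p q r)
    go _ (inj₁ p) (inj₁ q) (inj₁ r) = ⊥-elim (no-three-X tx ty tz xy xz yz p q r)
    go (inj₂ p) (inj₂ q) (inj₂ r) _ = ⊥-elim (no-three-Y tw tx ty wx wy xy p q r)
    go (inj₂ p) (inj₂ q) _ (inj₂ r) = ⊥-elim (no-three-Y tw tx tz wx wz xz p q r)
    go (inj₂ p) _ (inj₂ q) (inj₂ r) = ⊥-elim (no-three-Y tw ty tz wy wz yz p q r)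
    go _ (inj₂ p) (inj₂ q) (inj₂ r) = ⊥-elim (no-three-Y tx ty tz xy xz yz p q r)
    go (inj₁ p) (inj₁ q) (inj₂ r) (inj₂ s) = two-and-two high tw tx ty tz wx wy wz xy xz yz p q r s
    go (inj₁ p) (inj₂ r) (inj₁ q) (inj₂ s) = two-and-two high tw ty tx tz wy wx wz yx yz xz p q r s
    go (inj₁ p) (inj₂ r) (inj₂ s) (inj₁ q) = two-and-two high tw tz tx ty wz wx wy zx zy xy p q r s
    go (inj₂ r) (inj₁ p) (inj₁ q) (inj₂ s) = two-and-two high tx ty tw tz xy xw xz yw yz wz p q r s
    go (inj₂ r) (inj₁ p) (inj₂ s) (inj₁ q) = two-and-two high tx tz tw ty xz xw xy zw zy wy p q r s
    go (inj₂ r) (inj₂ s) (inj₁ p) (inj₁ q) = two-and-two high ty tz tw tx yz yw yx zw zx wx p q r s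
  no-low {[]} _ ()
  no-low {_ ∷ []} _ (s≤s ())
  no-low {_ ∷ _ ∷ []} _ (s≤s (s≤s ()))
  no-low {_ ∷ _ ∷ _ ∷ []} _ (s≤s (s≤s (s≤s ())))

  _≪_ : Point → Point → Set
  (x , y) ≪ (x′ , y′) = x < x′ × y < y′

  -- Minimality in x alone singles out the least low solution, because x determines y among low
  -- solutions.
  low-or-high : ∀ L → All Solution L → All (λ q → X-type q ⊎ Y-type q) L ⊎
    (∃[ o ] (o ∈ L × Low o × All (λ q → Low q → proj₁ o ≤ proj₁ q) L))
  low-or-high [] [] = inj₁ []
  low-or-high (q ∷ L) (t ∷ ts) with classify q t | low-or-high L ts
  ... | inj₁ h | inj₁ hs = inj₁ (inj₁ h ∷ hs)
  ... | inj₂ (inj₁ h) | inj₁ hs = inj₁ (inj₂ h ∷ hs)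
  ... | inj₂ (inj₂ l) | inj₁ hs = inj₂ (q , here refl , l , (λ _ → ≤-refl) ∷ All.map (λ {q′} h l′ → ⊥-elim (high-not-low {q′} h l′)) hs)
    where
    high-not-low : ∀ {q} → X-type q ⊎ Y-type q → Low q → ⊥
    high-not-low (inj₁ (e , _)) (_ , lt) = <-irrefl e lt
    high-not-low (inj₂ (_ , le)) (_ , lt) = <⇒≱ lt le
  ... | inj₁ (e , _) | inj₂ (o , o∈ , l , least) =
    inj₂ (o , there o∈ , l , (λ (_ , lt) → ⊥-elim (<-irrefl e lt)) ∷ least)
  ... | inj₂ (inj₁ (_ , le)) | inj₂ (o , o∈ , l , least) =
    inj₂ (o , there o∈ , l , (λ (_ , lt) → ⊥-elim (<⇒≱ lt le)) ∷ least)
  ... | inj₂ (inj₂ l′) | inj₂ (o , o∈ , l , least) with ≤-total (proj₁ o) (proj₁ q)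
  ...   | inj₁ le = inj₂ (o , there o∈ , l , (λ _ → le) ∷ least)
  ...   | inj₂ ge = inj₂ (q , here refl , l′ , (λ _ → ≤-refl) ∷ All.map (λ f l → ≤-trans ge (f l)) least)

  -- A solution that is not low has both valuations at least γ, above those of o. For two low
  -- solutions, vU = vW makes the orders in x and in y agree.
  above-low : ∀ {o q} → Low o → (Low q → proj₁ o ≤ proj₁ q) → Solution q → q ≡ o ⊎ o ≪ q
  above-low {x₀ , y₀} {x , y} (e , lt) least t with classify (x , y) t
  ... | inj₁ (eX , le) = inj₂ (vU-cancel-< (subst (vU x₀ <_) (sym eX) lt) , vW-cancel-< (≤-trans (subst (_< γ) e lt) le))
  ... | inj₂ (inj₁ (eY , le)) = inj₂ (vU-cancel-< (≤-trans lt le) , vW-cancel-< (subst₂ _<_ e (sym eY) lt))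
  ... | inj₂ (inj₂ l@(e′ , _)) with m≤n⇒m<n∨m≡n (least l)
  ...   | inj₁ x₀<x = inj₂ (x₀<x , vW-cancel-< (subst₂ _<_ e e′ (vU-mono-< x₀<x)))
  ...   | inj₂ refl = inj₁ (cong (x₀ ,_) (vW-injective (trans (sym e′) e)))

  -- If q were not low, both its valuations would be at least γ and both those of q′ would exceed γ,
  -- which `classify` forbids.
  ≪⇒low : ∀ {q q′} → q ≪ q′ → Solution q → Solution q′ → Low q
  ≪⇒low {x , y} {x′ , y′} (x< , y<) t t′ with classify (x , y) t | classify (x′ , y′) t′
  ... | inj₂ (inj₂ l) | _ = l
  ... | inj₁ (e , le) | inj₁ (e′ , _) = ⊥-elim (<-irrefl (trans e (sym e′)) (vU-mono-< x<))
  ... | inj₁ (e , le) | inj₂ (inj₁ (e′ , _)) = ⊥-elim (<⇒≱ (≤-trans (s≤s le) (vW-mono-< y<)) (≤-reflexive e′))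
  ... | inj₁ (e , le) | inj₂ (inj₂ (_ , lt)) = ⊥-elim (<-asym (vU-mono-< x<) (subst (vU x′ <_) (sym e) lt))
  ... | inj₂ (inj₁ (e , le)) | inj₁ (e′ , _) = ⊥-elim (<⇒≱ (≤-trans (s≤s le) (vU-mono-< x<)) (≤-reflexive e′))
  ... | inj₂ (inj₁ (e , le)) | inj₂ (inj₁ (e′ , _)) = ⊥-elim (<-irrefl (trans e (sym e′)) (vW-mono-< y<))
  ... | inj₂ (inj₁ (e , le)) | inj₂ (inj₂ (_ , lt)) = ⊥-elim (<⇒≱ (≤-trans (s≤s le) (vU-mono-< x<)) (<⇒≤ lt))

  module AtLow {x₀ y₀ : ℕ} (low : Low (x₀ , y₀)) (t₀ : Solution (x₀ , y₀)) where

    o : Point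
    o = x₀ , y₀

    Goal : Set
    Goal = Sporadic a b (U x₀) (W y₀) c

    shifted : ∀ {x y} → o ≪ (x , y) → Solution (x , y) → Tri (U x₀ * a ^ (x ∸ x₀)) (W y₀ * b ^ (y ∸ y₀)) c
    shifted (x< , y<) t = subst₂ (λ u w → Tri u w c) (U-shift (<⇒≤ x<)) (W-shift (<⇒≤ y<)) t

    -- A shared coordinate is a tie, and opposite orders in x and y are an inversion; both give the
    -- goal, and only comparable points remain.
    compare-points : ∀ {q q′} → o ≪ q → o ≪ q′ → Solution q → Solution q′ → q ≢ q′ → Goal ⊎ q ≪ q′ ⊎ q′ ≪ q
    compare-points {x , y} {x′ , y′} lt@(x< , y<) lt′@(x<′ , y<′) t t′ q≢q′ with <-cmp x x′ | <-cmp y y′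
    ... | tri≈ _ refl _ | tri≈ _ refl _ = ⊥-elim (q≢q′ refl)
    ... | tri≈ _ refl _ | tri< l _ _ = inj₁ (tie⇒sporadic 2≤a 2≤b (0<U x₀) (0<W y₀) t₀ (m<n⇒0<n∸m x<) (m<n⇒0<n∸m y<)
            (∸-monoˡ-< l (<⇒≤ y<)) (shifted lt t) (shifted lt′ t′))
    ... | tri≈ _ refl _ | tri> _ _ l = inj₁ (tie⇒sporadic 2≤a 2≤b (0<U x₀) (0<W y₀) t₀ (m<n⇒0<n∸m x<) (m<n⇒0<n∸m y<′)
            (∸-monoˡ-< l (<⇒≤ y<′)) (shifted lt′ t′) (shifted lt t))
    ... | tri< l _ _ | tri≈ _ refl _ = inj₁ (Sporadic-swap {b} {a} {W y₀} {U x₀} (tie⇒sporadic 2≤b 2≤a (0<W y₀) (0<U x₀) (Tri-swap t₀)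
            (m<n⇒0<n∸m y<) (m<n⇒0<n∸m x<) (∸-monoˡ-< l (<⇒≤ x<)) (Tri-swap (shifted lt t)) (Tri-swap (shifted lt′ t′))))
    ... | tri> _ _ l | tri≈ _ refl _ = inj₁ (Sporadic-swap {b} {a} {W y₀} {U x₀} (tie⇒sporadic 2≤b 2≤a (0<W y₀) (0<U x₀) (Tri-swap t₀)
            (m<n⇒0<n∸m y<) (m<n⇒0<n∸m x<′) (∸-monoˡ-< l (<⇒≤ x<′)) (Tri-swap (shifted lt′ t′)) (Tri-swap (shifted lt t))))
    ... | tri< l _ _ | tri> _ _ m = inj₁ (inversion⇒sporadic 2≤a 2≤b (0<U x₀) (0<W y₀) t₀ (m<n⇒0<n∸m x<) (m<n⇒0<n∸m y<′)
            (∸-monoˡ-< l (<⇒≤ x<)) (∸-monoˡ-< m (<⇒≤ y<′)) (shifted lt t) (shifted lt′ t′))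
    ... | tri> _ _ l | tri< m _ _ = inj₁ (inversion⇒sporadic 2≤a 2≤b (0<U x₀) (0<W y₀) t₀ (m<n⇒0<n∸m x<′) (m<n⇒0<n∸m y<)
            (∸-monoˡ-< l (<⇒≤ x<′)) (∸-monoˡ-< m (<⇒≤ y<)) (shifted lt′ t′) (shifted lt t))
    ... | tri< l _ _ | tri< m _ _ = inj₂ (inj₁ (l , m))
    ... | tri> _ _ l | tri> _ _ m = inj₂ (inj₂ (l , m))

    -- vU = vW holds at both low points; subtracting leaves equal valuations for the powers of a and
    -- b gained since the base point.
    increment : ∀ {x y} → o ≪ (x , y) → Low (x , y) → (x ∸ x₀) * α ≡ (y ∸ y₀) * β
    increment {x} {y} (x< , y<) (e , _) = +-cancelˡ-≡ (vU x₀) _ _ (trans (split ρ α x₀ x (<⇒≤ x<))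
      (trans e (trans (sym (split σ β y₀ y (<⇒≤ y<))) (cong (_+ (y ∸ y₀) * β) (sym (proj₁ low))))))
      where
      split : ∀ ρ α x₀ x → x₀ ≤ x → ρ + x₀ * α + (x ∸ x₀) * α ≡ ρ + x * α
      split ρ α x₀ x le = trans (+-assoc ρ _ _) (cong (ρ +_) (trans (sym (*-distribʳ-+ α x₀ (x ∸ x₀)))
        (cong (_* α) (m+[n∸m]≡n le))))

    -- The top solution serves to make the middle one low; the equations of the lower two are the
    -- ones fed to `chain⇒sporadic`.
    chain : ∀ {q₁ q₂ q₃} → o ≪ q₁ → q₁ ≪ q₂ → q₂ ≪ q₃ → Solution q₁ → Solution q₂ → Solution q₃ → Goal
    chain {q₁} {q₂} lt₁@(x< , _) (x<′ , y<′) lt₃ t₁ t₂ t₃ =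
      chain⇒sporadic {j = proj₂ q₁ ∸ y₀} {j′ = proj₂ q₂ ∸ y₀} pp va vb 1≤α 1≤β 2≤a 2≤b (0<U x₀) (0<W y₀) 0<c t₀ (m<n⇒0<n∸m x<) (∸-monoˡ-< x<′ (<⇒≤ x<))
        (increment lt₁ (≪⇒low (x<′ , y<′) t₁ t₂)) (increment lt₂ (≪⇒low lt₃ t₂ t₃)) (shifted lt₁ t₁) (shifted lt₂ t₂)
      where
      lt₂ = <-trans x< x<′ , <-trans (proj₂ lt₁) y<′

    three-above : ∀ {q₁ q₂ q₃} → o ≪ q₁ → o ≪ q₂ → o ≪ q₃ → Solution q₁ → Solution q₂ → Solution q₃ →
      q₁ ≢ q₂ → q₁ ≢ q₃ → q₂ ≢ q₃ → Goal
    three-above l₁ l₂ l₃ t₁ t₂ t₃ d₁₂ d₁₃ d₂₃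
      with compare-points l₁ l₂ t₁ t₂ d₁₂ | compare-points l₁ l₃ t₁ t₃ d₁₃ | compare-points l₂ l₃ t₂ t₃ d₂₃
    ... | inj₁ g | _ | _ = g
    ... | _ | inj₁ g | _ = g
    ... | _ | _ | inj₁ g = g
    ... | inj₂ (inj₁ c₁₂) | _ | inj₂ (inj₁ c₂₃) = chain l₁ c₁₂ c₂₃ t₁ t₂ t₃
    ... | inj₂ (inj₁ c₁₂) | inj₂ (inj₁ c₁₃) | inj₂ (inj₂ c₃₂) = chain l₁ c₁₃ c₃₂ t₁ t₃ t₂
    ... | inj₂ (inj₁ c₁₂) | inj₂ (inj₂ c₃₁) | inj₂ (inj₂ _) = chain l₃ c₃₁ c₁₂ t₃ t₁ t₂
    ... | inj₂ (inj₂ c₂₁) | inj₂ (inj₁ c₁₃) | _ = chain l₂ c₂₁ c₁₃ t₂ t₁ t₃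
    ... | inj₂ (inj₂ c₂₁) | inj₂ (inj₂ c₃₁) | inj₂ (inj₁ c₂₃) = chain l₂ c₂₃ c₃₁ t₂ t₃ t₁
    ... | inj₂ (inj₂ c₂₁) | inj₂ (inj₂ _) | inj₂ (inj₂ c₃₂) = chain l₃ c₃₂ c₂₁ t₃ t₂ t₁

  based : ∀ {L} → Unique L → 4 ≤ length L → All Solution L → Based L
  based {L} unique 4≤ ts with low-or-high L ts
  ... | inj₁ high = no-low unique 4≤ ts high
  ... | inj₂ ((x₀ , y₀) , o∈ , low , least)
    with q₁ , q₂ , q₃ , m₁ , m₂ , m₃ , n₁ , n₂ , n₃ , d₁₂ , d₁₃ , d₂₃ ← three-others unique 4≤ o∈ =
    x₀ , y₀ , All.tabulate (λ m → dominates (position m)) ,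
    AtLow.three-above low (All.lookup ts o∈) (strict m₁ n₁) (strict m₂ n₂) (strict m₃ n₃)
      (All.lookup ts m₁) (All.lookup ts m₂) (All.lookup ts m₃) d₁₂ d₁₃ d₂₃
    where
    position : ∀ {q} → q ∈ L → q ≡ (x₀ , y₀) ⊎ (x₀ , y₀) ≪ q
    position m = above-low low (All.lookup least m) (All.lookup ts m)
    dominates : ∀ {q} → q ≡ (x₀ , y₀) ⊎ (x₀ , y₀) ≪ q → Dominates (x₀ , y₀) q
    dominates (inj₁ refl) = ≤-refl , ≤-refl
    dominates (inj₂ (x< , y<)) = <⇒≤ x< , <⇒≤ y<
    strict : ∀ {q} → q ∈ L → q ≢ (x₀ , y₀) → (x₀ , y₀) ≪ q
    strict m q≢o with position m
    ... | inj₁ e = ⊥-elim (q≢o e)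
    ... | inj₂ lt = lt

open import Data.Bool using (true; false)
open import Data.Fin using (Fin; zero; suc)
open import Data.Fin.Properties using (injective⇒≤)
open import Data.Integer as ℤ using (+_; -_)
import Data.Integer.Properties as ℤ
open import Data.Rational as ℚ using (ℚ)
import Data.Rational.Properties as ℚ
open import Data.Rational.Unnormalised as ℚᵘ using (mkℚᵘ; *≡*)
import Data.Rational.Unnormalised.Properties as ℚᵘ

-- The finitely many remaining equations

tri? : ∀ U W c → Dec (Tri U W c)
tri? U W c = (U + W ≟ c) ⊎-dec ((U ≟ c + W) ⊎-dec (W ≟ c + U))

module _ (e : Entry) where
  open Entry e

  Certified : Set
  Certified = (2 ≤ A × 2 ≤ B) × (p ∣ A × p ∣ B × ¬ p ^ m ∣ C) ×
    (m ≤ n × C + R * A ^ m < S * B ^ n × C + S * B ^ m < R * A ^ n)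

  certified? : Dec Certified
  certified? = (2 ≤? A ×-dec 2 ≤? B) ×-dec (p ∣? A ×-dec p ∣? B ×-dec ¬? (p ^ m ∣? C)) ×-dec
    (m ≤? n ×-dec C + R * A ^ m <? S * B ^ n ×-dec C + S * B ^ m <? R * A ^ n)

  Solves : Point → Set
  Solves (i , j) = Tri (R * A ^ i) (S * B ^ j) C

  solves? : ∀ q → Dec (Solves q)
  solves? (i , j) = tri? (R * A ^ i) (S * B ^ j) C

  solutions : List Point
  solutions = filter solves? (cartesianProduct (upTo n) (upTo n))

^-mono-∣ : ∀ {p a} → p ∣ a → ∀ m → p ^ m ∣ a ^ m
^-mono-∣ p∣a zero = ∣-refl
^-mono-∣ p∣a (suc m) = *-pres-∣ p∣a (^-mono-∣ p∣a m)

m≤n⇒p^m∣a^n : ∀ {p a m n} → p ∣ a → m ≤ n → p ^ m ∣ a ^ n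
m≤n⇒p^m∣a^n {p} {a} {m} {n} p∣a m≤n = ∣-trans (^-mono-∣ p∣a m)
  (subst (a ^ m ∣_) (trans (sym (^-distribˡ-+-* a m (n ∸ m))) (cong (a ^_) (m+[n∸m]≡n m≤n))) (m∣m*n (a ^ (n ∸ m))))

exponent-bound : ∀ {A B R S C m n i j} → 2 ≤ A → 2 ≤ B → C + R * A ^ m < S * B ^ n → i < m →
  S * B ^ j ≤ C + R * A ^ i → j < n
exponent-bound {A} {B} {R} {S} {C} {m} {n} {i} {j} 2≤A 2≤B lt i<m le = ≰⇒> λ n≤j → <⇒≱ lt (begin
  S * B ^ n       ≤⟨ *-monoʳ-≤ S (^-monoʳ-≤ B {{2≤⇒nonZero 2≤B}} n≤j) ⟩
  S * B ^ j       ≤⟨ le ⟩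
  C + R * A ^ i   ≤⟨ +-monoʳ-≤ C (*-monoʳ-≤ R (^-monoʳ-≤ A {{2≤⇒nonZero 2≤A}} (<⇒≤ i<m))) ⟩
  C + R * A ^ m   ∎)
  where open ≤-Reasoning

enumerate : ∀ e → Certified e → ∀ q → Solves e q → q ∈ solutions e
enumerate e ((2≤A , 2≤B) , (p∣A , p∣B , p^m∤C) , (m≤n , lt , lt′)) (i , j) t =
  ∈-filter⁺ (solves? e) (box (i <? m) (j <? m)) t
  where
  open Entry e
  inside : i < n → j < n → (i , j) ∈ cartesianProduct (upTo n) (upTo n)
  inside i<n j<n = ∈-cartesianProduct⁺ (∈-upTo⁺ i<n) (∈-upTo⁺ j<n)
  box : Dec (i < m) → Dec (j < m) → (i , j) ∈ cartesianProduct (upTo n) (upTo n)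
  box (yes i<m) _ = inside (≤-trans i<m m≤n) (exponent-bound {A} {B} {R} {S} {C} {m} {n} 2≤A 2≤B lt i<m (Tri⇒W≤ t))
  box (no _) (yes j<m) = inside (exponent-bound {B} {A} {S} {R} {C} {m} {n} 2≤B 2≤A lt′ j<m (Tri⇒U≤ t)) (≤-trans j<m m≤n)
  -- With both exponents at least m, p ^ m divides both terms on the left and hence C.
  box (no i≮m) (no j≮m) = ⊥-elim (p^m∤C (Tri-∣c t
    (∣n⇒∣m*n R (m≤n⇒p^m∣a^n p∣A (≮⇒≥ i≮m))) (∣n⇒∣m*n S (m≤n⇒p^m∣a^n p∣B (≮⇒≥ j≮m)))))

table-certified : All Certified table
table-certified = from-yes (all? certified? table)

-- The searches are run by evaluation; by `enumerate` their results are complete, so these equations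
-- have at most three solutions.
sporadic-lengths : All (λ e → length (solutions e) ≡ 3) three-solutions
sporadic-lengths = refl ∷ refl ∷ refl ∷ refl ∷ refl ∷ refl ∷ refl ∷ refl ∷ []

-- Multiply the equation by C, replace u C and w C by u′ c and w′ c, and cancel c.
rescale : ∀ {u w c u′ w′ C} → 0 < c → u * C ≡ u′ * c → w * C ≡ w′ * c → Tri u w c → Tri u′ w′ C
rescale {u} {w} {c} {u′} {w′} {C} 0<c p q (sum-form e) = sum-form (*-cancelʳ-≡ (u′ + w′) C c {{>-nonZero 0<c}} (begin
  (u′ + w′) * c     ≡⟨ *-distribʳ-+ c u′ w′ ⟩
  u′ * c + w′ * c   ≡⟨ cong₂ _+_ p q ⟨
  u * C + w * C     ≡⟨ *-distribʳ-+ C u w ⟨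
  (u + w) * C       ≡⟨ cong (_* C) e ⟩
  c * C             ≡⟨ *-comm c C ⟩
  C * c             ∎))
  where open ≡-Reasoning
rescale {u} {w} {c} {u′} {w′} {C} 0<c p q (left-form e) = left-form (*-cancelʳ-≡ u′ (C + w′) c {{>-nonZero 0<c}} (begin
  u′ * c            ≡⟨ p ⟨
  u * C             ≡⟨ cong (_* C) e ⟩
  (c + w) * C       ≡⟨ *-distribʳ-+ C c w ⟩
  c * C + w * C     ≡⟨ cong₂ _+_ (*-comm c C) q ⟩
  C * c + w′ * c    ≡⟨ *-distribʳ-+ c C w′ ⟨
  (C + w′) * c      ∎))
  where open ≡-Reasoning
rescale {u} {w} 0<c p q (right-form e) = Tri-swap (rescale {w} {u} 0<c q p (left-form e))

scaled-term : ∀ {U C R c} X → U * C ≡ R * c → U * X * C ≡ R * X * c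
scaled-term {U} {C} {R} {c} X eq = begin
  U * X * C     ≡⟨ rearrange U X C ⟩
  U * C * X     ≡⟨ cong (_* X) eq ⟩
  R * c * X     ≡⟨ rearrange R c X ⟩
  R * X * c     ∎
  where
  open ≡-Reasoning
  rearrange : ∀ x y z → x * y * z ≡ x * z * y
  rearrange = solve-∀

fit⇒solves : ∀ {e a b U W c} → 0 < c → Fit e a b U W c → ∀ i j → Tri (U * a ^ i) (W * b ^ j) c → Solves e (i , j)
fit⇒solves {e} {U = U} {W} {c₀} 0<c (refl , refl , eqU , eqW) i j =
  rescale 0<c (scaled-term {U} {C} {R} {c₀} (A ^ i) eqU) (scaled-term {W} {C} {S} {c₀} (B ^ j) eqW)
  where open Entry e

-- From complete solution lists to families

lookup-injective : ∀ {A : Set} {xs : List A} → Unique xs → ∀ {i j} → lookup xs i ≡ lookup xs j → i ≡ j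
lookup-injective {xs = _ ∷ _} _ {zero} {zero} _ = refl
lookup-injective {xs = _ ∷ xs} (x∉ ∷ _) {zero} {suc j} eq = ⊥-elim (All.lookup x∉ (∈-lookup j) eq)
lookup-injective {xs = _ ∷ xs} (x∉ ∷ _) {suc i} {zero} eq = ⊥-elim (All.lookup x∉ (∈-lookup i) (sym eq))
lookup-injective {xs = _ ∷ _} (_ ∷ u) {suc i} {suc j} eq = cong suc (lookup-injective u eq)

-- Pigeonhole: sending each position of `xs` to the position of the same element in `ys` is
-- injective.
unique-⊆⇒length≤ : ∀ {A : Set} {xs ys : List A} → Unique xs → All (_∈ ys) xs → length xs ≤ length ys
unique-⊆⇒length≤ {xs = xs} {ys} unique sub = injective⇒≤ {f = position} λ {i} {j} eq →
  lookup-injective unique (trans (lookup-index (member i)) (trans (cong (lookup ys) eq) (sym (lookup-index (member j)))))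
  where
  member : ∀ i → lookup xs i ∈ ys
  member i = All.lookup sub (∈-lookup i)
  position : Fin (length xs) → Fin (length ys)
  position i = Any.index (member i)

-- Operations of ℚ normalise by a gcd, so the identity is moved to unnormalised fractions, where it
-- is a cross-multiplication.
rational-scale : ∀ C c .{{_ : NonZero c}} u w → C * u ≡ w * c → (+ C ℚ./ c) ℚ.* ℕtoℚ u ≡ ℕtoℚ w
rational-scale C (suc c) u w eq = ℚ.toℚᵘ-injective (begin
  ℚ.toℚᵘ ((+ C ℚ./ suc c) ℚ.* ℕtoℚ u)                ≈⟨ ℚ.toℚᵘ-homo-* (+ C ℚ./ suc c) (ℕtoℚ u) ⟩
  ℚ.toℚᵘ (+ C ℚ./ suc c) ℚᵘ.* ℚ.toℚᵘ (ℕtoℚ u)        ≈⟨ ℚᵘ.*-cong (ℚ.toℚᵘ-fromℚᵘ (mkℚᵘ (+ C) c)) (ℚ.toℚᵘ-fromℚᵘ (mkℚᵘ (+ u) 0)) ⟩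
  mkℚᵘ (+ C) c ℚᵘ.* mkℚᵘ (+ u) 0                     ≈⟨ *≡* cross-multiplied ⟩
  mkℚᵘ (+ w) 0                                       ≈⟨ ℚ.toℚᵘ-fromℚᵘ (mkℚᵘ (+ w) 0) ⟨
  ℚ.toℚᵘ (ℕtoℚ w)                                    ∎)
  where
  open import Relation.Binary.Reasoning.Setoid ℚᵘ.≃-setoid
  cross-multiplied : (+ C ℤ.* + u) ℤ.* + 1 ≡ + w ℤ.* + (suc c * 1)
  cross-multiplied = trans (ℤ.*-identityʳ (+ C ℤ.* + u)) (trans (sym (ℤ.pos-* C u))
    (trans (cong +_ (trans eq (cong (w *_) (sym (*-identityʳ (suc c)))))) (ℤ.pos-* w (suc c * 1))))

signed⇒Tri : ∀ {a b c r s} → 0 < c → ∀ q → IsSolution a b c r s q → Tri (r * a ^ proj₁ q) (s * b ^ proj₂ q) c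
signed⇒Tri {a} {b} {c} {r} {s} 0<c (x , y) (u , v , eq) = go u v eq
  where
  U W : ℕ
  U = r * a ^ x
  W = s * b ^ y
  minus : ∀ {U W} → + U ℤ.+ - + W ≡ + c → U ≡ c + W
  minus {U} {W} e = ℤ.+-injective (begin
    + U                       ≡⟨ ℤ.+-identityʳ (+ U) ⟨
    + U ℤ.+ + 0               ≡⟨ cong (λ z → + U ℤ.+ z) (ℤ.+-inverseˡ (+ W)) ⟨
    + U ℤ.+ (- + W ℤ.+ + W)   ≡⟨ ℤ.+-assoc (+ U) (- + W) (+ W) ⟨
    + U ℤ.+ - + W ℤ.+ + W     ≡⟨ cong (λ z → z ℤ.+ + W) e ⟩
    + c ℤ.+ + W               ∎)
    where open ≡-Reasoning
  go : ∀ u v → signed u (+ U) ℤ.+ signed v (+ W) ≡ + c → Tri U W c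
  go false false e = sum-form (ℤ.+-injective e)
  go false true e = left-form (minus e)
  go true false e = right-form (minus (trans (ℤ.+-comm (+ W) (- + U)) e))
  -- Two minus signs would make c equal to -(U + W). The value U + W = 0 is treated apart, because -
  -- 0 is itself of the form + 0.
  go true true e = ⊥-elim (negative (U + W) 0<c (trans (ℤ.neg-distrib-+ (+ U) (+ W)) e))
    where
    negative : ∀ n {c} → 0 < c → - + n ≡ + c → ⊥
    negative zero 0<c refl = 1+n≰n 0<c
    negative (suc n) 0<c ()

prime-divisor : ∀ n → 1 < n → ∃[ p ] (Prime p × p ∣ n)
prime-divisor 1 (s≤s ())
prime-divisor n@(suc (suc _)) _ with factorise n
... | record { factors = [] ; isFactorisation = () }
... | record { factors = p ∷ ps ; isFactorisation = eq ; factorsPrime = pp ∷ _ } =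
  p , pp , subst (p ∣_) (sym eq) (m∣m*n _)

-- An upper bound for the solutions relative to the base point. It serves both to count the pairs
-- and to find a partner for each of them.
Covers : (a b U W c : ℕ) → List Point → Set
Covers a b U W c M = ∀ i j → Tri (U * a ^ i) (W * b ^ j) c → (i , j) ∈ M

fit⇒covers : ∀ {a b U W c} e → 0 < c → Certified e → Fit e a b U W c → Covers a b U W c (solutions e)
fit⇒covers {a} {b} {U} {W} {c} e 0<c cert fit i j t =
  enumerate e cert (i , j) (fit⇒solves {e} {a} {b} {U} {W} {c} 0<c fit i j t)

fit⇒covers′ : ∀ {a b U W c} e → 0 < c → Certified e → Fit e b a W U c → Covers a b U W c (map swap (solutions e))
fit⇒covers′ {a} {b} {U} {W} {c} e 0<c cert fit i j t =
  ∈-map⁺ swap (fit⇒covers {b} {a} {W} {U} {c} e 0<c cert fit j i (Tri-swap t))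

module Family (S : SolSet) (x₀ y₀ : ℕ) (0<c : 0 < c S)
  (unique : Unique (pairs S)) (4≤ : 4 ≤ length (pairs S))
  (above : All (λ q → x₀ ≤ proj₁ q × y₀ ≤ proj₂ q) (pairs S))
  (sols : All (λ q → Tri (r S * a S ^ proj₁ q) (s S * b S ^ proj₂ q) (c S)) (pairs S)) where

  U₀ W₀ : ℕ
  U₀ = r S * a S ^ x₀
  W₀ = s S * b S ^ y₀

  shift : Point → Point
  shift (i , j) = x₀ + i , y₀ + j

  factor : ∀ r a {x₀ x} → x₀ ≤ x → r * a ^ x ≡ r * a ^ x₀ * a ^ (x ∸ x₀)
  factor r a {x₀} {x} le = trans (cong (r *_) (trans (cong (a ^_) (sym (m+[n∸m]≡n le)))
    (^-distribˡ-+-* a x₀ (x ∸ x₀)))) (sym (*-assoc r (a ^ x₀) _))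

  module _ {M : List Point} (covers : Covers (a S) (b S) U₀ W₀ (c S) M) where

    relative : ∀ {x y} → (x , y) ∈ pairs S → (x ∸ x₀ , y ∸ y₀) ∈ M
    relative {x} {y} m with x₀≤x , y₀≤y ← All.lookup above m =
      covers (x ∸ x₀) (y ∸ y₀) (subst₂ (λ u w → Tri u w (c S)) (factor (r S) (a S) x₀≤x) (factor (s S) (b S) y₀≤y)
        (All.lookup sols m))

    shifted-∈ : ∀ {q} → q ∈ pairs S → q ∈ map shift M
    shifted-∈ {x , y} m with x₀≤x , y₀≤y ← All.lookup above m =
      subst (_∈ map shift M) (cong₂ _,_ (m+[n∸m]≡n x₀≤x) (m+[n∸m]≡n y₀≤y)) (∈-map⁺ shift (relative m))

    length≤ : length (pairs S) ≤ length M
    length≤ = ≤-trans (unique-⊆⇒length≤ unique (All.tabulate shifted-∈)) (≤-reflexive (length-map shift M))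

    too-few : length M ≡ 3 → ⊥
    too-few eq = 1+n≰n (≤-trans 4≤ (≤-trans length≤ (≤-reflexive eq)))

  -- Take k = c T / c S. `Scaled` says that k carries the terms at (x₀ , y₀) to r T and s T, so (x ,
  -- y) is matched with (x - x₀ , y - y₀). The covering list bounds the length by four from above.
  same-family : (T : SolSet) → 0 < c T → length (pairs T) ≡ 4 → a S ≡ a T → b S ≡ b T →
    Scaled (r T) (s T) (c T) U₀ W₀ (c S) → Covers (a S) (b S) U₀ W₀ (c S) (pairs T) → SameFamily S T
  same-family T 0<C len a≡ b≡ (eqU , eqW) covers =
    trans (≤-antisym (≤-trans (length≤ covers) (≤-reflexive len)) 4≤) (sym len) ,
    powers a≡ , powers b≡ , k , ℚ.normalize-pos (c T) (c S) ,
    rational-scale (c T) (c S) (c S) (c T) refl , All.tabulate λ m → lose (relative covers m) (match m)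
    where
    instance
      c≢0 : NonZero (c S)
      c≢0 = >-nonZero 0<c
      C≢0 : NonZero (c T)
      C≢0 = >-nonZero 0<C
    powers : ∀ {m n} → m ≡ n → PowersOfOne m n
    powers {m} refl = m , 1 , 1 , sym (*-identityʳ m) , sym (*-identityʳ m)
    k : ℚ
    k = + c T ℚ./ c S
    term : ∀ {r₁ a₁ R A x₁ x} → a₁ ≡ A → r₁ * a₁ ^ x₁ * c T ≡ R * c S → x₁ ≤ x →
           c T * (r₁ * a₁ ^ x) ≡ R * A ^ (x ∸ x₁) * c S
    term {r₁} {a₁} {R} {x₁ = x₁} {x} refl eq le = trans (*-comm (c T) _) (trans (cong (_* c T) (factor r₁ a₁ le))
      (scaled-term {r₁ * a₁ ^ x₁} {c T} {R} {c S} (a₁ ^ (x ∸ x₁)) eq))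
    match : ∀ {x y} → (x , y) ∈ pairs S →
      (k ℚ.* ℕtoℚ (r S * a S ^ x) ≡ ℕtoℚ (r T * a T ^ (x ∸ x₀))) ×
      (k ℚ.* ℕtoℚ (s S * b S ^ y) ≡ ℕtoℚ (s T * b T ^ (y ∸ y₀)))
    match {x} {y} m with x₀≤x , y₀≤y ← All.lookup above m =
      rational-scale (c T) (c S) (r S * a S ^ x) (r T * a T ^ (x ∸ x₀)) (term {r S} {a S} {r T} {a T} {x₀} a≡ eqU x₀≤x) ,
      rational-scale (c T) (c S) (s S * b S ^ y) (s T * b T ^ (y ∸ y₀)) (term {s S} {b S} {s T} {b T} {y₀} b≡ eqW y₀≤y)

  direct : ∀ e T → Certified e → solutions e ≡ pairs T → length (pairs T) ≡ 4 → 0 < c T →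
    e ≡ entry (a T) (b T) (r T) (s T) (c T) (Entry.p e) (Entry.m e) (Entry.n e) →
    Fit e (a S) (b S) U₀ W₀ (c S) → SameFamily S T
  direct e T cert sols≡ len 0<C refl fit@(a≡ , b≡ , sc) = same-family T 0<C len a≡ b≡ sc
    (subst (Covers (a S) (b S) U₀ W₀ (c S)) sols≡ (fit⇒covers {a S} {b S} {U₀} {W₀} e 0<c cert fit))

  swapped : ∀ e T → Certified e → map swap (solutions e) ≡ pairs T → length (pairs T) ≡ 4 → 0 < c T →
    e ≡ entry (b T) (a T) (s T) (r T) (c T) (Entry.p e) (Entry.m e) (Entry.n e) →
    Fit e (b S) (a S) W₀ U₀ (c S) → SameFamily S T
  swapped e T cert sols≡ len 0<C refl fit@(b≡ , a≡ , (eqW , eqU)) = same-family T 0<C len a≡ b≡ (eqU , eqW)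
    (subst (Covers (a S) (b S) U₀ W₀ (c S)) sols≡ (fit⇒covers′ {a S} {b S} {U₀} {W₀} e 0<c cert fit))

  Position : List Entry → Set
  Position = Any (λ e → Fit e (a S) (b S) U₀ W₀ (c S) ⊎ Fit e (b S) (a S) W₀ U₀ (c S))

  -- Four distinct pairs, shifted to the base point, would have to fit into a list of three.
  discard : ∀ {es} → All Certified es → All (λ e → length (solutions e) ≡ 3) es → Position es → ⊥
  discard {e ∷ _} (cert ∷ _) (len ∷ _) (here (inj₁ fit)) =
    too-few (fit⇒covers {a S} {b S} {U₀} {W₀} e 0<c cert fit) len
  discard {e ∷ _} (cert ∷ _) (len ∷ _) (here (inj₂ fit)) =
    too-few (fit⇒covers′ {a S} {b S} {U₀} {W₀} e 0<c cert fit) (trans (length-map swap (solutions e)) len)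
  discard (_ ∷ certs) (_ ∷ lens) (there pos) = discard certs lens pos

  exceptional : ∀ {es} → All Certified (e₁ ∷ e₂ ∷ e₃ ∷ es) → All (λ e → length (solutions e) ≡ 3) es →
    Position (e₁ ∷ e₂ ∷ e₃ ∷ es) → Any (SameFamily S) Exceptional
  exceptional (cert ∷ _) _ (here (inj₁ fit)) =
    there (there (there (here (direct e₁ (associate E₁) cert refl refl (s≤s z≤n) refl fit))))
  exceptional (cert ∷ _) _ (here (inj₂ fit)) = here (swapped e₁ E₁ cert refl refl (s≤s z≤n) refl fit)
  exceptional (_ ∷ cert ∷ _) _ (there (here (inj₁ fit))) =
    there (here (direct e₂ E₂ cert refl refl (s≤s z≤n) refl fit))
  exceptional (_ ∷ cert ∷ _) _ (there (here (inj₂ fit))) =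
    there (there (there (there (here (swapped e₂ (associate E₂) cert refl refl (s≤s z≤n) refl fit)))))
  exceptional (_ ∷ _ ∷ cert ∷ _) _ (there (there (here (inj₁ fit)))) =
    there (there (here (direct e₃ E₃ cert refl refl (s≤s z≤n) refl fit)))
  exceptional (_ ∷ _ ∷ cert ∷ _) _ (there (there (here (inj₂ fit)))) =
    there (there (there (there (there (here (swapped e₃ (associate E₃) cert refl refl (s≤s z≤n) refl fit))))))
  exceptional (_ ∷ _ ∷ _ ∷ certs) lens (there (there (there pos))) = ⊥-elim (discard certs lens pos)

all-Tri : ∀ S → 0 < c S → All (IsSolution (a S) (b S) (c S) (r S) (s S)) (pairs S) →
  All (λ q → Tri (r S * a S ^ proj₁ q) (s S * b S ^ proj₂ q) (c S)) (pairs S)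
all-Tri S 0<c = All.map λ {q} → signed⇒Tri {a S} {b S} {c S} {r S} {s S} 0<c q

at-most-three : (S : SolSet) → Standing S → 1 < gcd (a S) (b S) → IsSetOfSolutions S →
  4 ≤ length (pairs S) → Any (SameFamily S) Exceptional
at-most-three S (2≤a , 2≤b , 0<c , 0<r , 0<s) 1<g (unique , _ , sols) 4≤
  with p , pp , p∣g ← prime-divisor (gcd (a S) (b S)) 1<g
  with α , va ← val-exists pp (a S) (<-trans (s≤s z≤n) 2≤a) | β , vb ← val-exists pp (b S) (<-trans (s≤s z≤n) 2≤b)
     | _ , vr ← val-exists pp (r S) 0<r | _ , vs ← val-exists pp (s S) 0<s | _ , vc ← val-exists pp (c S) 0<c
  with x₀ , y₀ , above , sporadic ← Solutions.based 2≤a 2≤b 0<c 0<r 0<s pp va vb vr vs vc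
         (∣⇒val (∣-trans p∣g (gcd[m,n]∣m (a S) (b S))) va) (∣⇒val (∣-trans p∣g (gcd[m,n]∣n (a S) (b S))) vb)
         unique 4≤ (all-Tri S 0<c sols)
  = Family.exceptional S x₀ y₀ 0<c unique 4≤ above (all-Tri S 0<c sols)
      table-certified sporadic-lengths sporadic

-- Infinitely many basic forms with three solutions

2∤odd : ∀ n → ¬ 2 ∣ 1 + 2 * n
2∤odd n d = 1+n≰n (∣⇒≤ (∣m+n∣m⇒∣n (subst (2 ∣_) (+-comm 1 (2 * n)) d) (m∣m*n n)))

2∣^⇒2∣ : ∀ t k → 2 ∣ t ^ k → 2 ∣ t
2∣^⇒2∣ t zero d = ⊥-elim (1+n≰n (∣⇒≤ d))
2∣^⇒2∣ t (suc k) d = [ (λ p → p) , 2∣^⇒2∣ t k ]′ (euclidsLemma t (t ^ k) prime[2] d)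

-- If twice an odd number were tᵏ with k ≥ 2, then t would be even and 4 would divide it.
twice-odd-not-power : ∀ n → ¬ PerfectPower (2 * (1 + 2 * n))
twice-odd-not-power n (t , suc (suc k) , s≤s (s≤s _) , eq) =
  2∤odd n (*-cancelˡ-∣ 2 (subst (2 * 2 ∣_) (sym eq) (*-pres-∣ 2∣t (∣m⇒∣m*n (t ^ k) 2∣t))))
  where
  2∣t : 2 ∣ t
  2∣t = 2∣^⇒2∣ t (2 + k) (subst (2 ∣_) eq (m∣m*n (1 + 2 * n)))

difference-ℤ : ∀ {U W c} → U ≡ c + W → + U ℤ.+ - + W ≡ + c
difference-ℤ {W = W} {c} refl = trans (ℤ.+-assoc (+ c) (+ W) (- + W))
  (trans (cong (λ z → + c ℤ.+ z) (ℤ.+-inverseʳ (+ W))) (ℤ.+-identityʳ (+ c)))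

-- Requiring c = s − r and solutions (1,1), (2,4) means (a+1)/(b+1) = (a²−1)/(b⁴−1) = s/r, whence a = b³ − b² + b.
-- Taking b ≡ 2 (mod 4) makes a and b twice an odd number, hence not perfect powers, and r coprime to s.
module Example (m : ℕ) where

  B A C R S : ℕ
  B = 2 + 4 * m
  A = B * (1 + (1 + 4 * m) * B)
  C = B * B * (1 + 4 * m)
  R = 3 + 4 * m
  S = 1 + A

  example : SolSet
  example = ⟨ A , B , C , R , S ⨾ (0 , 0) ∷ (1 , 1) ∷ (2 , 4) ∷ [] ⟩


  solution₀₀ : IsSolution A B C R S (0 , 0)
  solution₀₀ = true , false , trans (ℤ.+-comm (- + (R * 1)) (+ (S * 1))) (difference-ℤ (identity (4 * m)))
    where
    identity : ∀ k → (1 + (2 + k) * (1 + (1 + k) * (2 + k))) * 1 ≡ (2 + k) * (2 + k) * (1 + k) + (3 + k) * 1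
    identity = solve-∀

  solution₁₁ : IsSolution A B C R S (1 , 1)
  solution₁₁ = false , true , difference-ℤ (identity (4 * m))
    where
    identity : ∀ k → (3 + k) * ((2 + k) * (1 + (1 + k) * (2 + k)) * 1) ≡
      (2 + k) * (2 + k) * (1 + k) + (1 + (2 + k) * (1 + (1 + k) * (2 + k))) * ((2 + k) * 1)
    identity = solve-∀

  solution₂₄ : IsSolution A B C R S (2 , 4)
  solution₂₄ = true , false , trans (ℤ.+-comm (- + (R * A ^ 2)) (+ (S * B ^ 4))) (difference-ℤ (identity (4 * m)))
    where
    identity : ∀ k → (1 + (2 + k) * (1 + (1 + k) * (2 + k))) * ((2 + k) * ((2 + k) * ((2 + k) * ((2 + k) * 1)))) ≡
      (2 + k) * (2 + k) * (1 + k) + (3 + k) * ((2 + k) * (1 + (1 + k) * (2 + k)) * ((2 + k) * (1 + (1 + k) * (2 + k)) * 1))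
    identity = solve-∀

  -- By `identity`, S + 2 is a multiple of R, so d divides 2 and hence the even number B; as R = B +
  -- 1, d divides 1.
  common-divisor : ∀ {d} → d ∣ R → d ∣ S → d ≡ 1
  common-divisor {d} d∣R d∣S = ∣1⇒≡1 (∣m+n∣m⇒∣n (subst (d ∣_) (+-comm 1 B) d∣R) (∣-trans d∣2 2∣B))
    where
    identity : ∀ k → (3 + k) * (3 + 2 * k + k * k) ≡ 1 + (2 + k) * (1 + (1 + k) * (2 + k)) + 2
    identity = solve-∀
    d∣2 : d ∣ 2
    d∣2 = ∣m+n∣m⇒∣n (subst (d ∣_) (identity (4 * m)) (∣m⇒∣m*n (3 + 2 * (4 * m) + 4 * m * (4 * m)) d∣R)) d∣S
    2∣B : 2 ∣ B
    2∣B = divides (1 + 2 * m) (B≡ m)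
      where
      B≡ : ∀ m → 2 + 4 * m ≡ (1 + 2 * m) * 2
      B≡ = solve-∀

  -- R = 1 + B, so d divides S R - S B = S. In the same way S = 1 + A serves for `S-coprime`.
  R-coprime : Coprime R (S * B)
  R-coprime {d} (d∣R , d∣SB) = common-divisor d∣R
    (∣m+n∣m⇒∣n (subst (d ∣_) (trans (*-suc S B) (+-comm S (S * B))) (∣n⇒∣m*n S d∣R)) d∣SB)

  S-coprime : Coprime S (R * A)
  S-coprime {d} (d∣S , d∣RA) = common-divisor
    (∣m+n∣m⇒∣n (subst (d ∣_) (trans (*-suc R A) (+-comm R (R * A))) (∣n⇒∣m*n R d∣S)) d∣RA) d∣S

  A-not-power : ¬ PerfectPower A
  -- A / 2 = (1 + 2 m) (1 + (1 + 4 m) B) is odd because B is even; the argument is half of A / 2 -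
  -- 1.
  A-not-power = subst (λ n → ¬ PerfectPower n) (A≡ m) (twice-odd-not-power (m + (1 + 4 * m) * (1 + 2 * m) * (1 + 2 * m)))
    where
    A≡ : ∀ m → 2 * (1 + 2 * (m + (1 + 4 * m) * (1 + 2 * m) * (1 + 2 * m))) ≡ (2 + 4 * m) * (1 + (1 + 4 * m) * (2 + 4 * m))
    A≡ = solve-∀

  B-not-power : ¬ PerfectPower B
  B-not-power = subst (λ n → ¬ PerfectPower n) (B≡ m) (twice-odd-not-power m)
    where
    B≡ : ∀ m → 2 * (1 + 2 * m) ≡ 2 + 4 * m
    B≡ = solve-∀

  B≤gcd : B ≤ gcd A B
  B≤gcd = ∣⇒≤ {{≢-nonZero λ g≡0 → 1+n≢0 {1 + 4 * m} (gcd[m,n]≡0⇒n≡0 A {B} g≡0)}} (gcd-greatest {A} {B} (m∣m*n (1 + (1 + 4 * m) * B)) ∣-refl)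

infinitely-many : (m : ℕ) → ∃[ S ] (Standing S × 1 < gcd (a S) (b S) × IsSetOfSolutions S ×
  BasicForm S × length (pairs S) ≡ 3 × m ≤ size S)
infinitely-many m = example ,
  (s≤s (s≤s z≤n) , s≤s (s≤s z≤n) , s≤s z≤n , s≤s z≤n , s≤s z≤n) ,
  ≤-trans (s≤s (s≤s z≤n)) B≤gcd ,
  ((((λ ()) ∷ (λ ()) ∷ []) ∷ ((λ ()) ∷ []) ∷ [] ∷ []) , s≤s (s≤s (s≤s z≤n)) ,
    solution₀₀ ∷ solution₁₁ ∷ solution₂₄ ∷ []) ,
  (coprime⇒gcd≡1 R-coprime , coprime⇒gcd≡1 S-coprime , here refl , here refl , A-not-power , B-not-power) ,
  refl , m≤size
  where
  open Example m
  m≤size : m ≤ size example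
  m≤size = ≤-trans (≤-trans (m≤n*m m 4) (m≤n+m (4 * m) 2)) (≤-trans (m≤n+m B A)
    (≤-trans (m≤m+n (A + B) C) (≤-trans (m≤m+n _ R) (≤-trans (m≤m+n _ S) (m≤m+n _ 8)))))

theorem1 : ((S : SolSet) → Standing S → 1 < gcd (a S) (b S) → IsSetOfSolutions S →
    4 ≤ length (pairs S) → Any (SameFamily S) Exceptional)
    ×
    ((m : ℕ) → ∃[ S ] (Standing S × 1 < gcd (a S) (b S) × IsSetOfSolutions S ×
    BasicForm S × length (pairs S) ≡ 3 × m ≤ size S))
theorem1 = at-most-three , infinitely-many
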